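{- Let $G$ be a split comparability graph. Then $\mathcal{R}(G) = 3$ if and only if $G$ contains an induced subgraph isomorphic to $F_0$ or to $F_1(5)$.
   Context: A split graph is a graph whose vertex set partitions into a clique and an independent set; a comparability graph is a graph admitting a transitive orientation (comparability graphs are word-representable). For a word $w$ and letters $a,b$, $w|_{\{a,b\}}$ is the subsequence of $w$ of all occurrences of $a$ and $b$; $a,b$ alternate in $w$ if $w|_{\{a,b\}}$ is $abab\cdots$ or $baba\cdots$ (any length). A graph $G=(V,E)$ is represented by a word $w$ over $V$ if for distinct $a,b\in V$, $ab\in E$ iff $a,b$ alternate in $w$. A word is $k$-uniform if each letter occurs exactly $k$ times; $\mathcal{R}(G)$ is the least $k$ such that a $k$-uniform word represents $G$. $F_0$: vertices $0,c_1,c_2,c_3,c_4,a_1,a_2,a_3$; $\{0,c_1,c_2,c_3,c_4\}$ is a clique, $\{a_1,a_2,a_3\}$ is independent, $N(a_1)=\{0,c_2,c_3\}$, $N(a_2)=\{0,c_3,c_4\}$, $N(a_3)=\{0,c_1,c_4\}$. $F_1(5)$: vertices $c_1,c_2,c_3,c_4,b_1,b_2,a_1,a_2,a_3$; $\{c_1,c_2,c_3,c_4\}$ is a clique, $\{b_1,b_2,a_1,a_2,a_3\}$ is independent, $N(b_1)=\{c_1,c_2,c_3\}$, $N(b_2)=\{c_2,c_3,c_4\}$, $N(a_i)=\{c_i,c_{i+1}\}$ for $i=1,2,3$. -}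

module Defs where

open import Data.Nat using (ℕ; zero; suc; _≤_; _<_)
open import Data.Nat.Properties using () renaming (_≟_ to _≟ℕ_)
open import Data.Fin using (Fin; zero; suc; toℕ)
open import Data.Fin.Properties using (_≟_)
open import Data.Bool using (Bool; true; false; _∨_; _∧_)
open import Data.List using (List; []; _∷_; filter; length)
open import Data.Bool.ListAction using (any)
open import Data.Product using (Σ; _×_; _,_; ∃)
open import Data.Sum using (_⊎_)
open import Data.Unit using (⊤)
open import Data.Empty using (⊥)
open import Relation.Nullary using (¬_; does)
open import Relation.Nullary.Decidable using (_⊎-dec_)
open import Relation.Binary.PropositionalEquality using (_≡_; _≢_; refl)
open import Function.Definitions using (Injective)

record Graph : Set where
  field
    n     : ℕ
    adj   : Fin n → Fin n → Bool
    sym   : ∀ x y → adj x y ≡ adj y x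
    irrefl : ∀ x → adj x x ≡ false

open Graph public

Edge : (G : Graph) → Fin (n G) → Fin (n G) → Set
Edge G x y = adj G x y ≡ true

IsSplit : Graph → Set
IsSplit G = Σ (Fin (n G) → Bool) λ inK →
    (∀ x y → x ≢ y → inK x ≡ true → inK y ≡ true → Edge G x y)
  × (∀ x y → inK x ≡ false → inK y ≡ false → ¬ Edge G x y)

IsTransitiveOrientation : (G : Graph) → (Fin (n G) → Fin (n G) → Bool) → Set
IsTransitiveOrientation G o =
    (∀ x y → o x y ≡ true → Edge G x y)
  × (∀ x y → Edge G x y → o x y ≡ true ⊎ o y x ≡ true)
  × (∀ x y → o x y ≡ true → o y x ≡ true → ⊥)
  × (∀ x y z → o x y ≡ true → o y z ≡ true → o x z ≡ true)

IsComparability : Graph → Set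
IsComparability G = Σ (Fin (n G) → Fin (n G) → Bool) (IsTransitiveOrientation G)

module _ {m : ℕ} where

  restrict : List (Fin m) → Fin m → Fin m → List (Fin m)
  restrict w a b = filter (λ x → (x ≟ a) ⊎-dec (x ≟ b)) w

  -- a word over the two letters {a,b} is abab… or baba… (any length)
  -- iff no two consecutive letters are equal
  NoTwoConsecutiveEqual : List (Fin m) → Set
  NoTwoConsecutiveEqual []           = ⊤
  NoTwoConsecutiveEqual (x ∷ [])     = ⊤
  NoTwoConsecutiveEqual (x ∷ y ∷ r)  = x ≢ y × NoTwoConsecutiveEqual (y ∷ r)

  Alternate : List (Fin m) → Fin m → Fin m → Set
  Alternate w a b = NoTwoConsecutiveEqual (restrict w a b)

  count : Fin m → List (Fin m) → ℕ
  count a w = length (filter (λ x → x ≟ a) w)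

  Uniform : ℕ → List (Fin m) → Set
  Uniform k w = ∀ a → count a w ≡ k

Represents : (G : Graph) → List (Fin (n G)) → Set
Represents G w = ∀ a b → a ≢ b →
  (Edge G a b → Alternate w a b) × (Alternate w a b → Edge G a b)

HasUniformRep : Graph → ℕ → Set
HasUniformRep G k = Σ (List (Fin (n G))) λ w → Uniform k w × Represents G w

RepNumberIs : Graph → ℕ → Set
RepNumberIs G k = HasUniformRep G k × (∀ j → 1 ≤ j → j < k → ¬ HasUniformRep G j)

ContainsInduced : (G H : Graph) → Set
ContainsInduced G H = Σ (Fin (n H) → Fin (n G)) λ f →
  Injective _≡_ _≡_ f × (∀ x y → adj H x y ≡ adj G (f x) (f y))

private
  memPair : List (ℕ × ℕ) → ℕ → ℕ → Bool
  memPair es i j = any (λ { (p , q) → does (p ≟ℕ i) ∧ does (q ≟ℕ j) }) es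

  edgeAdj : ∀ {k} → List (ℕ × ℕ) → Fin k → Fin k → Bool
  edgeAdj es x y = memPair es (toℕ x) (toℕ y) ∨ memPair es (toℕ y) (toℕ x)

  ∨-comm : ∀ a b → (a ∨ b) ≡ (b ∨ a)
  ∨-comm false false = refl
  ∨-comm false true  = refl
  ∨-comm true  false = refl
  ∨-comm true  true  = refl

-- F₀: 0 ↦ 0, c₁..c₄ ↦ 1..4, a₁..a₃ ↦ 5..7
F₀-edges : List (ℕ × ℕ)
F₀-edges =
  (0 , 1) ∷ (0 , 2) ∷ (0 , 3) ∷ (0 , 4) ∷ (1 , 2) ∷ (1 , 3) ∷ (1 , 4) ∷
  (2 , 3) ∷ (2 , 4) ∷ (3 , 4) ∷
  (5 , 0) ∷ (5 , 2) ∷ (5 , 3) ∷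
  (6 , 0) ∷ (6 , 3) ∷ (6 , 4) ∷
  (7 , 0) ∷ (7 , 1) ∷ (7 , 4) ∷ []

-- F₁(5): c₁..c₄ ↦ 0..3, b₁,b₂ ↦ 4,5, a₁..a₃ ↦ 6..8
F₁₅-edges : List (ℕ × ℕ)
F₁₅-edges =
  (0 , 1) ∷ (0 , 2) ∷ (0 , 3) ∷ (1 , 2) ∷ (1 , 3) ∷ (2 , 3) ∷
  (4 , 0) ∷ (4 , 1) ∷ (4 , 2) ∷
  (5 , 1) ∷ (5 , 2) ∷ (5 , 3) ∷
  (6 , 0) ∷ (6 , 1) ∷ (7 , 1) ∷ (7 , 2) ∷ (8 , 2) ∷ (8 , 3) ∷ []

F₀ : Graph
F₀ = record
  { n = 8
  ; adj = edgeAdj F₀-edges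
  ; sym = λ x y → ∨-comm (memPair F₀-edges (toℕ x) (toℕ y)) (memPair F₀-edges (toℕ y) (toℕ x))
  ; irrefl = irr
  }
  where
    irr : ∀ x → edgeAdj F₀-edges x x ≡ false
    irr zero = refl
    irr (suc zero) = refl
    irr (suc (suc zero)) = refl
    irr (suc (suc (suc zero))) = refl
    irr (suc (suc (suc (suc zero)))) = refl
    irr (suc (suc (suc (suc (suc zero))))) = refl
    irr (suc (suc (suc (suc (suc (suc zero)))))) = refl
    irr (suc (suc (suc (suc (suc (suc (suc zero))))))) = refl

F₁₅ : Graph
F₁₅ = record
  { n = 9
  ; adj = edgeAdj F₁₅-edges
  ; sym = λ x y → ∨-comm (memPair F₁₅-edges (toℕ x) (toℕ y)) (memPair F₁₅-edges (toℕ y) (toℕ x))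
  ; irrefl = irr
  }
  where
    irr : ∀ x → edgeAdj F₁₅-edges x x ≡ false
    irr zero = refl
    irr (suc zero) = refl
    irr (suc (suc zero)) = refl
    irr (suc (suc (suc zero))) = refl
    irr (suc (suc (suc (suc zero)))) = refl
    irr (suc (suc (suc (suc (suc zero))))) = refl
    irr (suc (suc (suc (suc (suc (suc zero)))))) = refl
    irr (suc (suc (suc (suc (suc (suc (suc zero))))))) = refl
    irr (suc (suc (suc (suc (suc (suc (suc (suc zero)))))))) = refl

module Submission where

-- A transitive orientation makes the clique a chain in which the neighbourhood of each independent vertex
-- a is the union of the first x a and the last y a vertices, every initial segment being disjoint from
-- every final one.  The poset obtained has dimension at most 3, and concatenating three linear extensions
-- that realise it gives a 3-uniform word.
--
-- A 2-uniform word is a chord diagram.  The clique is drawn as diameters, and an independent vertex a as a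
-- chord cutting off the interval [-y a, x a], at either of two antipodal places.  Two chords at the same
-- place cross iff x a < x b, y b < y a and not x a = y b = 0, so a 2-uniform word exists as soon as the
-- graph of these clashes is bipartite.  A chain x a₁ < x a₂ < x a₃, y a₁ > y a₂ > y a₃ forces F₀ unless
-- x a₁ = y a₃ = 0; under this restriction a clash graph that is not bipartite contains the 5-cycle of F₁(5).
-- That F₀ and F₁(5) themselves have no 2-uniform word is a finite search.

open import Defs
open import Data.Bool using (Bool; true; false; T; not; if_then_else_; _∧_; _∨_)
open import Data.Bool.ListAction using (all)
import Data.Bool.Properties as Bool
open import Data.Bool.Properties using (¬-not) renaming (_≟_ to _≟ᵇ_)
open import Data.Fin using (Fin; zero; suc; toℕ; #_; splitAt; _↑ˡ_; _↑ʳ_)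
open import Data.Fin.Patterns using (0F; 1F; 2F; 3F; 4F)
import Data.Fin.Properties as Fin
open import Data.Fin.Properties using (_≟_)
open import Data.List using (List; []; _∷_; [_]; _++_; map; filter; length; concatMap; allFin)
import Data.List.Properties as List
open import Data.List.Membership.Propositional using (_∈_; _∉_)
open import Data.List.Membership.Propositional.Properties
  using (∈-filter⁺; ∈-filter⁻; ∈-allFin; ∈-map⁺; ∈-++⁺ˡ; ∈-++⁺ʳ)
open import Data.List.Membership.Propositional.Properties.WithK using (unique∧set⇒bag)
open import Data.List.Relation.Binary.BagAndSetEquality using (∼bag⇒↭)
open import Data.List.Relation.Binary.Permutation.Propositional
  using (_↭_; ↭-refl; ↭-sym; ↭-trans; ↭-reflexive; prep; swap; ↭⇒↭ₛ′)
import Data.List.Relation.Binary.Permutation.Propositional.Properties as ↭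
import Data.List.Relation.Binary.Pointwise as Pointwise
open import Data.List.Relation.Unary.All as All using (All; []; _∷_)
import Data.List.Relation.Unary.All.Properties as All
open import Data.List.Relation.Unary.AllPairs using ([]; _∷_)
open import Data.List.Relation.Unary.Any using (here; there)
open import Data.List.Relation.Unary.Linked using (Linked; []; [-]; _∷_)
import Data.List.Relation.Unary.Sorted.TotalOrder.Properties as Sorted
open import Data.List.Relation.Unary.Unique.Propositional using (Unique)
import Data.List.Relation.Unary.Unique.Propositional.Properties as Unique
open import Data.Nat as ℕ using (ℕ; zero; suc; _≤_; _<_; _+_; _*_; _∸_; _⊔_; s≤s; z≤n)
import Data.Nat.Properties as ℕ
open import Data.Product using (_×_; _,_; proj₁; proj₂; Σ; ∃) renaming (swap to ×-swap)
open import Data.Product.Relation.Binary.Lex.NonStrict using (×-decTotalOrder)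
open import Data.Product.Relation.Binary.Pointwise.NonDependent using (≡×≡⇒≡)
open import Data.Sum using (_⊎_; inj₁; inj₂; [_,_]′) renaming (swap to ⊎-swap)
open import Data.Unit using (tt)
open import Data.Vec using ([]; _∷_; lookup)
open import Function using (_∘_; _$_; id; mk⇔; Equivalence)
open import Function.Definitions using (Injective)
open import Relation.Binary.Bundles using (DecTotalOrder)
open import Relation.Binary.Definitions using (tri<; tri≈; tri>)
open import Relation.Binary.PropositionalEquality as ≡
  using (_≡_; _≢_; refl; cong; cong₂; subst; subst₂; module ≡-Reasoning)
open import Relation.Nullary using (¬_; Dec; yes; no; does; contradiction)
open import Relation.Nullary.Decidable using (_×-dec_; _⊎-dec_; ¬?; toWitness; dec-true; dec-false)
open import Relation.Unary using (Decidable)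

-- Both graphs are odd cycles of clashes. The relation `◁` is transitive, so if every pair `a ◁ b`
-- were a clash, the clash graph would be the comparability graph of a strict order, bipartite
-- exactly when there is no chain of three; the triangle of clashes on such a chain is what `F₀`
-- records. But if x a = y b = 0, the two chords only touch at the centre and can be drawn disjoint.
-- A chain a₁ ◁ a₂ ◁ a₃ with x a₁ = y a₃ = 0 therefore yields the path a₁, a₂, a₃ instead of a
-- triangle, and `F₁₅` closes this path to the 5-cycle a₁, a₂, a₃, b₂, b₁. Chords at antipodal
-- places never obstruct, because initial segments end by t and final segments start no earlier. All
-- words are given by numeric keys, so that every claim about alternation becomes a few inequalities
-- between keys.

private variable
  h k : ℕ

-- Words read off from numeric keys.

filter-map : ∀ {A B : Set} {P : B → Set} (P? : Decidable P) (f : A → B) (xs : List A) →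
             filter P? (map f xs) ≡ map f (filter (P? ∘ f) xs)
filter-map P? f [] = refl
filter-map P? f (x ∷ xs) with P? (f x)
... | yes _ = cong (f x ∷_) (filter-map P? f xs)
... | no  _ = filter-map P? f xs

restrict-comm : (w : List (Fin k)) (a b : Fin k) → restrict w a b ≡ restrict w b a
restrict-comm w a b = List.filter-≐ _ _ ([ inj₂ , inj₁ ]′ , [ inj₂ , inj₁ ]′) w

-- The letter v is written at each of the times keys v; sorting the pairs (time, letter) yields the word.
module KeyedWord {m : ℕ} (keys : Fin m → List ℕ) where

  tokenOrder : DecTotalOrder _ _ _
  tokenOrder = ×-decTotalOrder ℕ.≤-decTotalOrder (Fin.≤-decTotalOrder m)

  open import Data.List.Sort tokenOrder using (sort; sort-↭; sort-↗)
  open DecTotalOrder tokenOrder using (totalOrder)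

  Token : Set
  Token = ℕ × Fin m

  tokens : Fin m → List Token
  tokens v = map (_, v) (keys v)

  word : List (Fin m)
  word = map proj₂ (sort (concatMap tokens (allFin m)))

  private
    _≺_ : Token → Token → Set
    s ≺ t = proj₁ s < proj₁ t

  module _ {P : (Fin m) → Set} (P? : Decidable P) where

    filter-tokens : ∀ vs → filter (P? ∘ proj₂) (concatMap tokens vs) ≡ concatMap tokens (filter P? vs)
    filter-tokens [] = refl
    filter-tokens (v ∷ vs) = ≡.trans (List.filter-++ (P? ∘ proj₂) (tokens v) _) (helper (P? v))
      where
      helper : Dec (P v) →
               filter (P? ∘ proj₂) (tokens v) ++ filter (P? ∘ proj₂) (concatMap tokens vs)
                 ≡ concatMap tokens (filter P? (v ∷ vs))
      helper (yes Pv) = ≡.trans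
        (cong₂ _++_ (List.filter-all (P? ∘ proj₂) (accepted Pv (keys v))) (filter-tokens vs))
        (cong (concatMap tokens) (≡.sym (List.filter-accept P? Pv)))
        where
        accepted : P v → ∀ ks → All (P ∘ proj₂) (map (_, v) ks)
        accepted Pv []       = []
        accepted Pv (k ∷ ks) = Pv ∷ accepted Pv ks
      helper (no ¬Pv) = ≡.trans
        (cong₂ _++_ (List.filter-none (P? ∘ proj₂) (rejected (keys v))) (filter-tokens vs))
        (cong (concatMap tokens) (≡.sym (List.filter-reject P? ¬Pv)))
        where
        rejected : ∀ ks → All (λ t → ¬ P (proj₂ t)) (map (_, v) ks)
        rejected []       = []
        rejected (k ∷ ks) = ¬Pv ∷ rejected ks

    -- Duplicate-free lists with the same members are permutations of each other. Hence the letters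
    -- kept by `P` may be given as an explicit list, such as `a ∷ b ∷ []`, instead of in the order
    -- of `allFin m`.
    filter-word : ∀ {vs} → Unique vs → (∀ {v} → v ∈ vs → P v) → (∀ {v} → P v → v ∈ vs) →
                  filter (P? ∘ proj₂) (sort (concatMap tokens (allFin m))) ↭ concatMap tokens vs
    filter-word {vs} uniq sound complete =
      ↭-trans (↭.filter-↭ (P? ∘ proj₂) (sort-↭ _)) $
      ↭-trans (↭-reflexive (filter-tokens (allFin m))) $
      concatMap-↭ (∼bag⇒↭ (unique∧set⇒bag (Unique.filter⁺ P? (Unique.allFin⁺ m)) uniq
        (mk⇔ (λ v∈ → complete (proj₂ (∈-filter⁻ P? {xs = allFin m} v∈)))
             (λ v∈ → ∈-filter⁺ P? (∈-allFin _) (sound v∈)))))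
      where
      concatMap-↭ : ∀ {us vs} → us ↭ vs → concatMap tokens us ↭ concatMap tokens vs
      concatMap-↭ _↭_.refl = ↭-refl
      concatMap-↭ (prep v us↭vs) = ↭.++⁺ˡ (tokens v) (concatMap-↭ us↭vs)
      concatMap-↭ (swap u v us↭vs) =
        ↭-trans (↭.++⁺ˡ (tokens u) (↭.++⁺ˡ (tokens v) (concatMap-↭ us↭vs)))
                (↭.shifts (tokens u) (tokens v))
      concatMap-↭ (_↭_.trans p q) = ↭-trans (concatMap-↭ p) (concatMap-↭ q)

  count-word : ∀ a → count a word ≡ length (keys a)
  count-word a = begin
    length (filter (_≟ a) word)
      ≡⟨ cong length (filter-map (_≟ a) proj₂ ts) ⟩
    length (map proj₂ (filter ((_≟ a) ∘ proj₂) ts))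
      ≡⟨ List.length-map proj₂ (filter ((_≟ a) ∘ proj₂) ts) ⟩
    length (filter ((_≟ a) ∘ proj₂) ts)
      ≡⟨ ↭.↭-length (filter-word (_≟ a) {a ∷ []} ([] ∷ []) (λ { (here v≡a) → v≡a }) here) ⟩
    length (tokens a ++ [])
      ≡⟨ cong length (List.++-identityʳ (tokens a)) ⟩
    length (tokens a)
      ≡⟨ List.length-map (_, a) (keys a) ⟩
    length (keys a) ∎
    where
    open ≡-Reasoning
    ts = sort (concatMap tokens (allFin m))

  -- A sorted list is determined by its members, so a restriction is computed by displaying the
  -- tokens of `a` and `b` in strictly increasing time. Strictness keeps the tie-break by letter out
  -- of play.
  restrict-word : ∀ {a b es} → a ≢ b → Linked _≺_ es → es ↭ tokens a ++ tokens b →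
                  restrict word a b ≡ map proj₂ es
  restrict-word {a} {b} {es} a≢b es↗ es↭ = begin
    restrict word a b           ≡⟨ filter-map P? proj₂ ts ⟩
    map proj₂ (filter (P? ∘ proj₂) ts)
      ≡⟨ cong (map proj₂) (Pointwise-lex⇒≡
           (Sorted.↗↭↗⇒≋ totalOrder (Sorted.filter⁺ totalOrder (P? ∘ proj₂) (sort-↗ _)) (weaken es↗)
             (↭⇒↭ₛ′ (DecTotalOrder.Eq.isEquivalence tokenOrder) (↭-trans filtered (↭-sym es↭))))) ⟩
    map proj₂ es ∎
    where
    open ≡-Reasoning
    ts = sort (concatMap tokens (allFin m))
    P? : Decidable (λ v → v ≡ a ⊎ v ≡ b)
    P? v = (v ≟ a) ⊎-dec (v ≟ b)
    weaken : ∀ {es} → Linked _≺_ es → Linked (DecTotalOrder._≤_ tokenOrder) es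
    weaken []         = []
    weaken [-]        = [-]
    weaken (s≺t ∷ ss) = inj₁ (ℕ.<⇒≤ s≺t , ℕ.<⇒≢ s≺t) ∷ weaken ss
    filtered : filter (P? ∘ proj₂) ts ↭ tokens a ++ tokens b
    filtered = ↭-trans
      (filter-word P? {a ∷ b ∷ []} ((a≢b ∷ []) ∷ [] ∷ [])
        (λ { (here v≡a) → inj₁ v≡a ; (there (here v≡b)) → inj₂ v≡b })
        [ here , there ∘ here ]′)
      (↭.++⁺ˡ (tokens a) (↭-reflexive (List.++-identityʳ (tokens b))))
    Pointwise-lex⇒≡ : ∀ {ss ts : List Token} → Pointwise.Pointwise (DecTotalOrder._≈_ tokenOrder) ss ts → ss ≡ ts
    Pointwise-lex⇒≡ = Pointwise.Pointwise-≡⇒≡ ∘ Pointwise.map ≡×≡⇒≡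

module Permutation {m : ℕ} (key : Fin m → ℕ) where
  open KeyedWord (λ v → key v ∷ []) public

  restrict-< : ∀ {a b} → key a < key b → restrict word a b ≡ a ∷ b ∷ []
  restrict-< ka<kb = restrict-word (λ { refl → ℕ.<-irrefl refl ka<kb }) (ka<kb ∷ [-]) ↭-refl

  restrict-> : ∀ {a b} → key b < key a → restrict word a b ≡ b ∷ a ∷ []
  restrict-> {a} {b} kb<ka = ≡.trans (restrict-comm word a b) (restrict-< kb<ka)

module ChordDiagram {m : ℕ} (start end : Fin m → ℕ) where
  open KeyedWord (λ v → start v ∷ end v ∷ []) public

  interlaced⇒alternate : ∀ {a b} → start a < start b → start b < end a → end a < end b →
                         Alternate word a b
  interlaced⇒alternate {a} {b} p q r =
    subst NoTwoConsecutiveEqual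
      (≡.sym (restrict-word a≢b (p ∷ q ∷ r ∷ [-]) (prep _ (swap _ _ ↭-refl))))
      (a≢b , a≢b ∘ ≡.sym , a≢b , tt)
    where
    a≢b : a ≢ b
    a≢b refl = ℕ.<-irrefl refl p

  nested⇒¬alternate : ∀ {a b} → start a < start b → start b < end b → end b < end a →
                      ¬ Alternate word a b
  nested⇒¬alternate {a} {b} p q r alt =
    proj₁ (proj₂ (subst NoTwoConsecutiveEqual
      (restrict-word a≢b (p ∷ q ∷ r ∷ [-])
        (prep _ (↭-trans (prep _ (swap _ _ ↭-refl)) (swap _ _ ↭-refl)))) alt)) refl
    where
    a≢b : a ≢ b
    a≢b refl = ℕ.<-irrefl refl p

  disjoint⇒¬alternate : ∀ {a b} → start a < end a → end a < start b → start b < end b →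
                        ¬ Alternate word a b
  disjoint⇒¬alternate {a} {b} p q r alt =
    proj₁ (subst NoTwoConsecutiveEqual (restrict-word a≢b (p ∷ q ∷ r ∷ [-]) ↭-refl) alt) refl
    where
    a≢b : a ≢ b
    a≢b refl = ℕ.<-asym p q

Agrees : (G : Graph) → List (Fin (n G)) → Fin (n G) → Fin (n G) → Set
Agrees G w a b = (Edge G a b × Alternate w a b) ⊎ (¬ Edge G a b × ¬ Alternate w a b)

Agrees-sym : ∀ G w {a b} → Agrees G w a b → Agrees G w b a
Agrees-sym G w {a} {b} (inj₁ (e , alt)) =
  inj₁ (≡.trans (sym G b a) e , subst NoTwoConsecutiveEqual (restrict-comm w a b) alt)
Agrees-sym G w {a} {b} (inj₂ (¬e , ¬alt)) =
  inj₂ (¬e ∘ ≡.trans (sym G a b) , ¬alt ∘ subst NoTwoConsecutiveEqual (restrict-comm w b a))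

agrees⇒represents : ∀ G w → (∀ {a b} → a ≢ b → Agrees G w a b) → Represents G w
agrees⇒represents G w agrees a b a≢b with agrees a≢b
... | inj₁ (e , alt)   = (λ _ → alt) , (λ _ → e)
... | inj₂ (¬e , ¬alt) = (λ e → contradiction e ¬e) , (λ alt → contradiction alt ¬alt)

m∸n≤o⇒m≤o+n : ∀ {m n o} → m ∸ n ≤ o → m ≤ o + n
m∸n≤o⇒m≤o+n {m} {n} {o} p = ℕ.≤-trans (ℕ.m≤n+m∸n m n) (ℕ.≤-trans (ℕ.+-monoʳ-≤ n p) (ℕ.≤-reflexive (ℕ.+-comm n o)))

-- The keys used below all have the form p * N + r with r < N, which encodes the lexicographic order
-- of the pairs (p, r).
lex-< : ∀ {p q r s N} → p < q → r < N → p * N + r < q * N + s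
lex-< {p} {q} {r} {s} {N} p<q r<N = begin-strict
  p * N + r    <⟨ ℕ.+-monoʳ-< (p * N) r<N ⟩
  p * N + N    ≡⟨ ℕ.+-comm (p * N) N ⟩
  suc p * N    ≤⟨ ℕ.*-monoˡ-≤ N p<q ⟩
  q * N        ≤⟨ ℕ.m≤m+n (q * N) s ⟩
  q * N + s    ∎
  where open ℕ.≤-Reasoning

-- Coordinates along the clique chain.

-- The clique is the chain of positions 0, …, m - 1; the neighbourhood of an independent vertex a
-- consists of the first x a and the last y a of them, and t separates all the initial segments
-- from all the final ones.
record Coordinates (G : Graph) : Set where
  field
    inK           : Fin (n G) → Bool
    m t           : ℕ
    pos x y       : Fin (n G) → ℕ
    clique        : ∀ {c d} → c ≢ d → inK c ≡ true → inK d ≡ true → Edge G c d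
    independent   : ∀ {a b} → inK a ≡ false → inK b ≡ false → ¬ Edge G a b
    pos<m         : ∀ {c} → inK c ≡ true → pos c < m
    pos-injective : ∀ {c d} → inK c ≡ true → inK d ≡ true → pos c ≡ pos d → c ≡ d
    x≤t           : ∀ a → x a ≤ t
    t+y≤m         : ∀ a → t + y a ≤ m
    edge⇒         : ∀ {c a} → inK c ≡ true → inK a ≡ false → Edge G c a → pos c < x a ⊎ m ≤ pos c + y a
    edge⇐         : ∀ {c a} → inK c ≡ true → inK a ≡ false → pos c < x a ⊎ m ≤ pos c + y a → Edge G c a
    x-clique      : ∀ {c} → inK c ≡ true → x c ≡ 0
    y-clique      : ∀ {c} → inK c ≡ true → y c ≡ 0
    x-positive    : ∀ {b} → 0 < x b → ∃ λ c → inK c ≡ true × pos c < x b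
    y-positive    : ∀ {b} → 0 < y b → ∃ λ c → inK c ≡ true × m ≤ pos c + y b
    x-separate    : ∀ {a b} → x a < x b → ∃ λ c → inK c ≡ true × x a ≤ pos c × pos c < x b
    y-separate    : ∀ {a b} → y a < y b → ∃ λ c → inK c ≡ true × pos c + y a < m × m ≤ pos c + y b

  y≤m : ∀ a → y a ≤ m
  y≤m a = ℕ.≤-trans (ℕ.m≤n+m (y a) t) (t+y≤m a)

  t≤m∸y : ∀ a → t ≤ m ∸ y a
  t≤m∸y a = ℕ.m+n≤o⇒m≤o∸n t (t+y≤m a)

  pos≷ : ∀ {c d} → c ≢ d → inK c ≡ true → inK d ≡ true → pos c < pos d ⊎ pos d < pos c
  pos≷ {c} {d} c≢d c∈K d∈K with ℕ.<-cmp (pos c) (pos d)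
  ... | tri< p _ _ = inj₁ p
  ... | tri≈ _ p _ = contradiction (pos-injective c∈K d∈K p) c≢d
  ... | tri> _ _ p = inj₂ p

toℕ≷ : {a b : Fin k} → a ≢ b → toℕ a < toℕ b ⊎ toℕ b < toℕ a
toℕ≷ {a = a} {b} a≢b with ℕ.<-cmp (toℕ a) (toℕ b)
... | tri< p _ _ = inj₁ p
... | tri≈ _ p _ = contradiction (Fin.toℕ-injective p) a≢b
... | tri> _ _ p = inj₂ p

-- A 3-uniform word from three linear extensions.

-- Orient the graph along the chain, an independent vertex a lying above the x a lowest and below the y a
-- highest clique vertices.  This poset is the intersection of three linear extensions:
-- insert each a as low as possible, as high as possible, or at the height t with the order of the
-- independent vertices reversed.
module ThreeUniform {G : Graph} (C : Coordinates G) where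
  open Coordinates C

  N B : ℕ
  N = n G
  B = 2 * t * N + N

  -- Clique position p has the odd height 2p + 1, and the gap just below position g the even height
  -- 2g. The factor `N` leaves room for the index that orders the vertices in one gap. In `middle`
  -- the tie-break is `B ∸ low v`, which needs the wider factor `suc B`; as `B` bounds `low` on
  -- independent vertices, the truncated subtraction really reverses their order.
  low high middle : Fin (n G) → ℕ
  low v    = if inK v then suc (2 * pos v) * N else 2 * x v * N + toℕ v
  high v   = if inK v then suc (2 * pos v) * N else 2 * (m ∸ y v) * N + toℕ v
  middle v = if inK v then suc (2 * pos v) * suc B else 2 * t * suc B + (B ∸ low v)

  middle-independent : ∀ {a} → inK a ≡ false → middle a ≡ 2 * t * suc B + (B ∸ low a)
  middle-independent {a} a∉K with false ← inK a = refl

  module L = Permutation low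
  module H = Permutation high
  module M = Permutation middle

  -- `L` stands between the other two because every incomparable pair is reversed between `low` and
  -- one of them: a clique and an independent vertex in `high`, two independent vertices in
  -- `middle`. A reversal puts the same letter on both sides of a seam.
  word : List (Fin (n G))
  word = H.word ++ L.word ++ M.word

  private
    restrict-++ : ∀ u w (a b : Fin (n G)) → restrict (u ++ w) a b ≡ restrict u a b ++ restrict w a b
    restrict-++ u w a b = List.filter-++ _ u w

    split : ∀ a b → restrict word a b ≡ restrict H.word a b ++ restrict L.word a b ++ restrict M.word a b
    split a b = ≡.trans (restrict-++ H.word (L.word ++ M.word) a b)
                        (cong (restrict H.word a b ++_) (restrict-++ L.word M.word a b))

    before-gap : ∀ {p g N r} → p < g → 0 < N → suc (2 * p) * N < 2 * g * N + r
    before-gap {p} {g} {N} {r} p<g 0<N = subst (_< 2 * g * N + r) (ℕ.+-identityʳ _)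
      (lex-< {suc (2 * p)} {2 * g} {0} {r} {N} (begin
        2 + 2 * p   ≡⟨ ℕ.*-suc 2 p ⟨
        2 * suc p   ≤⟨ ℕ.*-monoʳ-≤ 2 p<g ⟩
        2 * g       ∎) 0<N)
      where open ℕ.≤-Reasoning

    after-gap : ∀ {p g N r} → g ≤ p → r < N → 2 * g * N + r < suc (2 * p) * N
    after-gap {p} {g} {N} {r} g≤p r<N = subst (2 * g * N + r <_) (ℕ.+-identityʳ _)
      (lex-< {2 * g} {suc (2 * p)} {r} {0} {N} (s≤s (ℕ.*-monoʳ-≤ 2 g≤p)) r<N)

    0<N : Fin (n G) → 0 < N
    0<N a = ℕ.≤-<-trans z≤n (Fin.toℕ<n a)

  alike : ∀ {a b} → low a < low b → high a < high b → middle a < middle b → Alternate word a b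
  alike {a} {b} p q r = subst NoTwoConsecutiveEqual
    (≡.sym (≡.trans (split a b) (cong₂ _++_ (H.restrict-< q) (cong₂ _++_ (L.restrict-< p) (M.restrict-< r)))))
    (a≢b , a≢b ∘ ≡.sym , a≢b , a≢b ∘ ≡.sym , a≢b , tt)
    where
    a≢b : a ≢ b
    a≢b refl = ℕ.<-irrefl refl p

  low-high-differ : ∀ {a b} → low a < low b → high b < high a → ¬ Alternate word a b
  low-high-differ {a} {b} p q alt =
    proj₁ (proj₂ (subst NoTwoConsecutiveEqual
      (≡.trans (split a b) (cong₂ _++_ (H.restrict-> q) (cong (_++ restrict M.word a b) (L.restrict-< p)))) alt))
      refl

  low-middle-differ : ∀ {a b} → low a < low b → middle b < middle a → ¬ Alternate word a b
  low-middle-differ {a} {b} p r alt =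
    proj₁ (proj₂ (subst NoTwoConsecutiveEqual
      (cong₂ _++_ (L.restrict-< p) (M.restrict-> r))
      (dropPrefix (restrict H.word a b) (subst NoTwoConsecutiveEqual (split a b) alt)))) refl
    where
    dropPrefix : ∀ u {w} → NoTwoConsecutiveEqual (u ++ w) → NoTwoConsecutiveEqual w
    dropPrefix []              h       = h
    dropPrefix (_ ∷ []) {[]}    h       = tt
    dropPrefix (_ ∷ []) {_ ∷ _} (_ , h) = h
    dropPrefix (_ ∷ v ∷ u)     (_ , h) = dropPrefix (v ∷ u) h

  uniform : Uniform 3 word
  uniform a = begin
    length (filter (_≟ a) word)
      ≡⟨ cong length (≡.trans (List.filter-++ (_≟ a) H.word _)
           (cong (filter (_≟ a) H.word ++_) (List.filter-++ (_≟ a) L.word _))) ⟩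
    length (filter (_≟ a) H.word ++ filter (_≟ a) L.word ++ filter (_≟ a) M.word)
      ≡⟨ List.length-++ (filter (_≟ a) H.word) ⟩
    count a H.word + length (filter (_≟ a) L.word ++ filter (_≟ a) M.word)
      ≡⟨ cong₂ _+_ (H.count-word a) (List.length-++ (filter (_≟ a) L.word)) ⟩
    1 + (count a L.word + count a M.word)
      ≡⟨ cong suc (cong₂ _+_ (L.count-word a) (M.count-word a)) ⟩
    3 ∎
    where open ≡-Reasoning

  clique-agrees : ∀ {c d} → inK c ≡ true → inK d ≡ true → pos c < pos d → Agrees G word c d
  clique-agrees {c} {d} c∈K d∈K p = inj₁ (clique (λ { refl → ℕ.<-irrefl refl p }) c∈K d∈K , alike {c} {d} lo hi mi)
    where
    mono : ∀ N → 0 < N → suc (2 * pos c) * N < suc (2 * pos d) * N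
    mono (suc N) _ = ℕ.*-monoˡ-< (suc N) (s≤s (ℕ.*-monoʳ-< 2 p))
    lo : low c < low d
    lo rewrite c∈K | d∈K = mono N (0<N c)
    hi : high c < high d
    hi rewrite c∈K | d∈K = mono N (0<N c)
    mi : middle c < middle d
    mi rewrite c∈K | d∈K = mono (suc B) (s≤s z≤n)

  mixed-agrees : ∀ {c a} → inK c ≡ true → inK a ≡ false → Agrees G word c a
  mixed-agrees {c} {a} c∈K a∉K with ℕ.<-≤-connex (pos c) (x a) | ℕ.<-≤-connex (pos c) (m ∸ y a)
  ... | inj₁ p | _ = inj₁ (edge⇐ c∈K a∉K (inj₁ p) , alike {c} {a} lo hi mi)
    where
    p<t : pos c < t
    p<t = ℕ.<-≤-trans p (x≤t a)
    lo : low c < low a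
    lo rewrite c∈K | a∉K = before-gap p (0<N c)
    hi : high c < high a
    hi rewrite c∈K | a∉K = before-gap (ℕ.<-≤-trans p<t (t≤m∸y a)) (0<N c)
    mi : middle c < middle a
    mi rewrite c∈K | a∉K = before-gap p<t (s≤s z≤n)
  ... | inj₂ q | inj₁ p = inj₂
    ( (λ e → [ ℕ.≤⇒≯ q , ℕ.<⇒≱ (ℕ.m≤o∸n⇒m+n≤o _ (y≤m a) p) ]′ (edge⇒ c∈K a∉K e))
    , low-high-differ {a} {c} lo hi ∘ subst NoTwoConsecutiveEqual (restrict-comm word c a))
    where
    lo : low a < low c
    lo rewrite c∈K | a∉K = after-gap q (Fin.toℕ<n a)
    hi : high c < high a
    hi rewrite c∈K | a∉K = before-gap p (0<N c)
  ... | inj₂ q | inj₂ r = Agrees-sym G word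
    (inj₁ (≡.trans (sym G a c) (edge⇐ c∈K a∉K (inj₂ (m∸n≤o⇒m≤o+n r))) , alike {a} {c} lo hi mi))
    where
    lo : low a < low c
    lo rewrite c∈K | a∉K = after-gap q (Fin.toℕ<n a)
    hi : high a < high c
    hi rewrite c∈K | a∉K = after-gap r (Fin.toℕ<n a)
    mi : middle a < middle c
    mi rewrite c∈K | a∉K = after-gap (ℕ.≤-trans (t≤m∸y a) r) (s≤s (ℕ.m∸n≤m B (2 * x a * N + toℕ a)))

  low≷ : ∀ {a b} → a ≢ b → inK a ≡ false → inK b ≡ false → low a < low b ⊎ low b < low a
  low≷ {a} {b} a≢b a∉K b∉K rewrite a∉K | b∉K with ℕ.<-cmp (x a) (x b)
  ... | tri< p _ _ = inj₁ (lex-< (ℕ.*-monoʳ-< 2 p) (Fin.toℕ<n a))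
  ... | tri> _ _ p = inj₂ (lex-< (ℕ.*-monoʳ-< 2 p) (Fin.toℕ<n b))
  ... | tri≈ _ p _ rewrite p = [ inj₁ ∘ ℕ.+-monoʳ-< _ , inj₂ ∘ ℕ.+-monoʳ-< _ ]′ (toℕ≷ a≢b)

  independent-agrees : ∀ {a b} → inK a ≡ false → inK b ≡ false → low a < low b → Agrees G word a b
  independent-agrees {a} {b} a∉K b∉K p = inj₂ (independent a∉K b∉K , low-middle-differ {a} {b} p reversed)
    where
    b≤B : low b ≤ B
    b≤B rewrite b∉K = ℕ.+-mono-≤ (ℕ.*-monoˡ-≤ N (ℕ.*-monoʳ-≤ 2 (x≤t b))) (ℕ.<⇒≤ (Fin.toℕ<n b))
    drop : B ∸ low b < B ∸ low a
    drop = ℕ.∸-monoʳ-< p b≤B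
    reversed : middle b < middle a
    reversed = subst₂ _<_ (≡.sym (middle-independent b∉K)) (≡.sym (middle-independent a∉K))
                 (ℕ.+-monoʳ-< (2 * t * suc B) drop)

  agrees : ∀ {a b} → a ≢ b → Agrees G word a b
  agrees {a} {b} a≢b with inK a in a∈ | inK b in b∈
  ... | true  | true  = [ clique-agrees a∈ b∈ , Agrees-sym G word ∘ clique-agrees b∈ a∈ ]′ (pos≷ a≢b a∈ b∈)
  ... | true  | false = mixed-agrees a∈ b∈
  ... | false | true  = Agrees-sym G word (mixed-agrees b∈ a∈)
  ... | false | false = [ independent-agrees a∈ b∈ , Agrees-sym G word ∘ independent-agrees b∈ a∈ ]′
                        (low≷ a≢b a∈ b∈)

  representable : HasUniformRep G 3
  representable = word , uniform , agrees⇒represents G word agrees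

-- Coordinates from a transitive orientation, by counting.

sum : (Fin k → ℕ) → ℕ
sum {zero}  f = 0
sum {suc k} f = f zero + sum (f ∘ suc)

sum-mono : {f g : Fin k → ℕ} → (∀ i → f i ≤ g i) → sum f ≤ sum g
sum-mono {zero}  f≤g = z≤n
sum-mono {suc k} f≤g = ℕ.+-mono-≤ (f≤g zero) (sum-mono (f≤g ∘ suc))

sum-mono-< : {f g : Fin k → ℕ} → (∀ i → f i ≤ g i) → ∀ i → f i < g i → sum f < sum g
sum-mono-< f≤g zero    f<g = ℕ.+-mono-<-≤ f<g (sum-mono (f≤g ∘ suc))
sum-mono-< f≤g (suc i) f<g = ℕ.+-mono-≤-< (f≤g zero) (sum-mono-< (f≤g ∘ suc) i f<g)

sum-+ : (f g : Fin k → ℕ) → sum (λ i → f i + g i) ≡ sum f + sum g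
sum-+ {zero}  f g = refl
sum-+ {suc k} f g = begin
  (f zero + g zero) + sum (λ i → f (suc i) + g (suc i))  ≡⟨ cong (f zero + g zero +_) (sum-+ (f ∘ suc) (g ∘ suc)) ⟩
  (f zero + g zero) + (sum (f ∘ suc) + sum (g ∘ suc))    ≡⟨ ℕ.+-assoc (f zero) _ _ ⟩
  f zero + (g zero + (sum (f ∘ suc) + sum (g ∘ suc)))    
    ≡⟨ cong (f zero +_) (x∙yz≈y∙xz (g zero) (sum (f ∘ suc)) (sum (g ∘ suc))) ⟩
  f zero + (sum (f ∘ suc) + (g zero + sum (g ∘ suc)))    ≡⟨ ℕ.+-assoc (f zero) _ _ ⟨
  (f zero + sum (f ∘ suc)) + (g zero + sum (g ∘ suc))    ∎
  where
  open ≡-Reasoning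
  open import Algebra.Properties.CommutativeSemigroup ℕ.+-commutativeSemigroup using (x∙yz≈y∙xz)

sum-<-witness : {f g : Fin k → ℕ} → sum f < sum g → ∃ λ i → f i < g i
sum-<-witness {f = f} {g} lt with Fin.any? (λ i → f i ℕ.<? g i)
... | yes p = p
... | no ¬p = contradiction lt (ℕ.≤⇒≯ (sum-mono (λ i → ℕ.≮⇒≥ (λ q → ¬p (i , q)))))

maximum : (Fin k → ℕ) → ℕ
maximum {zero}  f = 0
maximum {suc k} f = f zero ⊔ maximum (f ∘ suc)

≤-maximum : (f : Fin k → ℕ) → ∀ i → f i ≤ maximum f
≤-maximum f zero    = ℕ.m≤m⊔n (f zero) _
≤-maximum f (suc i) = ℕ.≤-trans (≤-maximum (f ∘ suc) i) (ℕ.m≤n⊔m (f zero) _)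

maximum-≤ : (f : Fin k → ℕ) {b : ℕ} → (∀ i → f i ≤ b) → maximum f ≤ b
maximum-≤ {zero}  f f≤b = z≤n
maximum-≤ {suc k} f f≤b = ℕ.⊔-lub (f≤b zero) (maximum-≤ (f ∘ suc) (f≤b ∘ suc))

⟦_⟧ : Bool → ℕ
⟦ b ⟧ = if b then 1 else 0

⟦⟧-mono : ∀ {b c} → (b ≡ true → c ≡ true) → ⟦ b ⟧ ≤ ⟦ c ⟧
⟦⟧-mono {false} h = z≤n
⟦⟧-mono {true}  h rewrite h refl = s≤s z≤n

⟦⟧-disjoint : ∀ {b c d} → (b ≡ true → d ≡ true) → (c ≡ true → d ≡ true) → ¬ (b ≡ true × c ≡ true) →
              ⟦ b ⟧ + ⟦ c ⟧ ≤ ⟦ d ⟧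
⟦⟧-disjoint {false} {c}     hb hc hbc = ⟦⟧-mono hc
⟦⟧-disjoint {true}  {false} hb hc hbc = ⟦⟧-mono hb
⟦⟧-disjoint {true}  {true}  hb hc hbc = contradiction (refl , refl) hbc

⟦⟧-cover : ∀ {b c d} → (d ≡ true → b ≡ true ⊎ c ≡ true) → ⟦ d ⟧ ≤ ⟦ b ⟧ + ⟦ c ⟧
⟦⟧-cover {d = false} h = z≤n
⟦⟧-cover {b} {c} {true} h with h refl
... | inj₁ refl = s≤s z≤n
... | inj₂ refl = ℕ.m≤n+m 1 ⟦ b ⟧

⟦⟧-< : ∀ {b c} → b ≢ true → c ≡ true → ⟦ b ⟧ < ⟦ c ⟧
⟦⟧-< {false} _   refl = s≤s z≤n
⟦⟧-< {true}  b≢t _    = contradiction refl b≢t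

⟦⟧-<⁻ : ∀ {b c} → ⟦ b ⟧ < ⟦ c ⟧ → b ≢ true × c ≡ true
⟦⟧-<⁻ {false} {true}  _        = (λ ()) , refl
⟦⟧-<⁻ {true}  {true}  (s≤s ())

∧-true : ∀ {b c} → b ∧ c ≡ true → b ≡ true × c ≡ true
∧-true {true} {true} _ = refl , refl

∧-intro : ∀ {b c} → b ≡ true → c ≡ true → b ∧ c ≡ true
∧-intro refl refl = refl

module FromOrientation (G : Graph) (split : IsSplit G) (comparability : IsComparability G) where

  private
    V = Fin (n G)

    inK : V → Bool
    inK = proj₁ split

    _∈K _∈I : V → Set
    v ∈K = inK v ≡ true
    v ∈I = inK v ≡ false

    infix 4 _⇒_
    _⇒_ : V → V → Set
    u ⇒ v = proj₁ comparability u v ≡ true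

    clique : ∀ {c d} → c ≢ d → c ∈K → d ∈K → Edge G c d
    clique = proj₁ (proj₂ split) _ _

    independent : ∀ {a b} → a ∈I → b ∈I → ¬ Edge G a b
    independent = proj₂ (proj₂ split) _ _

    ⇒-edge : ∀ {u v} → u ⇒ v → Edge G u v
    ⇒-edge = proj₁ (proj₂ comparability) _ _

    edge-⇒ : ∀ {u v} → Edge G u v → u ⇒ v ⊎ v ⇒ u
    edge-⇒ = proj₁ (proj₂ (proj₂ comparability)) _ _

    ⇒-asym : ∀ {u v} → u ⇒ v → ¬ v ⇒ u
    ⇒-asym = proj₁ (proj₂ (proj₂ (proj₂ comparability))) _ _

    ⇒-trans : ∀ {u v w} → u ⇒ v → v ⇒ w → u ⇒ w
    ⇒-trans = proj₂ (proj₂ (proj₂ (proj₂ comparability))) _ _ _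

    ⇒-irrefl : ∀ {v} → ¬ v ⇒ v
    ⇒-irrefl v⇒v = ⇒-asym v⇒v v⇒v

    ⇒-total : ∀ {c d} → c ≢ d → c ∈K → d ∈K → c ⇒ d ⊎ d ⇒ c
    ⇒-total c≢d c∈K d∈K = edge-⇒ (clique c≢d c∈K d∈K)

    size : (V → Bool) → ℕ
    size p = sum (λ v → ⟦ p v ⟧)

    below above : V → V → Bool
    below v d = inK d ∧ proj₁ comparability d v
    above v d = inK d ∧ proj₁ comparability v d

    indeg outdeg : V → ℕ
    indeg v  = size (below v)
    outdeg v = size (above v)

    m : ℕ
    m = size inK

    ⇒⇒indeg< : ∀ {c v} → c ∈K → c ⇒ v → indeg c < indeg v
    ⇒⇒indeg< {c} {v} c∈K c⇒v = sum-mono-<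
      (λ d → ⟦⟧-mono {below c d} (λ d∈ → let d∈K , d⇒c = ∧-true {inK d} d∈ in ∧-intro d∈K (⇒-trans d⇒c c⇒v)))
      c (⟦⟧-< (⇒-irrefl ∘ proj₂ ∘ ∧-true {inK c}) (∧-intro c∈K c⇒v))

    -- A clique vertex d with d ⇒ v must satisfy d ⇒ c, since otherwise c ⇒ d ⇒ v.
    ¬⇒⇒indeg≤ : ∀ {c v} → c ∈K → ¬ c ⇒ v → indeg v ≤ indeg c
    ¬⇒⇒indeg≤ {c} {v} c∈K ¬c⇒v = sum-mono λ d → ⟦⟧-mono {below v d} λ d∈ → let d∈K , d⇒v = ∧-true {inK d} d∈ in
      ∧-intro d∈K ([ (λ d⇒c → d⇒c) , (λ c⇒d → contradiction (⇒-trans c⇒d d⇒v) ¬c⇒v) ]′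
        (⇒-total (λ { refl → ¬c⇒v d⇒v }) d∈K c∈K))

    -- The sets `below c` and `above v` cover the clique: a clique vertex that is not below c is c
    -- itself or lies above c, hence above v.
    ⇒⇒m≤ : ∀ {c v} → c ∈K → v ⇒ c → m ≤ indeg c + outdeg v
    ⇒⇒m≤ {c} {v} c∈K v⇒c = subst (m ≤_) (sum-+ (λ d → ⟦ below c d ⟧) (λ d → ⟦ above v d ⟧))
      (sum-mono λ d → ⟦⟧-cover {below c d} {above v d} {inK d} cover)
      where
      cover : ∀ {d} → d ∈K → below c d ≡ true ⊎ above v d ≡ true
      cover {d} d∈K with d ≟ c
      ... | yes refl = inj₂ (∧-intro d∈K v⇒c)
      ... | no  d≢c  = [ inj₁ ∘ ∧-intro d∈K , inj₂ ∘ ∧-intro d∈K ∘ ⇒-trans v⇒c ]′ (⇒-total d≢c d∈K c∈K)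

    -- The sets `below c` and `above v` are disjoint, and both miss c. The instance v = c bounds the
    -- position of c.
    ¬⇒⇒<m : ∀ {c v} → c ∈K → ¬ v ⇒ c → indeg c + outdeg v < m
    ¬⇒⇒<m {c} {v} c∈K ¬v⇒c = subst (_< m) (sum-+ (λ d → ⟦ below c d ⟧) (λ d → ⟦ above v d ⟧))
      (sum-mono-<
        (λ d → ⟦⟧-disjoint {below c d} {above v d} (proj₁ ∘ ∧-true) (proj₁ ∘ ∧-true)
          λ (d∈ , d∈′) → ¬v⇒c (⇒-trans (proj₂ (∧-true {inK d} d∈′)) (proj₂ (∧-true {inK d} d∈))))
        c (subst (_< ⟦ inK c ⟧) (≡.sym zero≡) (⟦⟧-< {false} (λ ()) c∈K)))
      where
      zero≡ : ⟦ below c c ⟧ + ⟦ above v c ⟧ ≡ 0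
      zero≡ = cong₂ (λ p q → ⟦ p ⟧ + ⟦ q ⟧)
        (¬-not (⇒-irrefl ∘ proj₂ ∘ ∧-true {inK c})) (¬-not (¬v⇒c ∘ proj₂ ∘ ∧-true {inK c}))

    -- A clique vertex is given the point (0, 0), which `◁` relates to no point with natural
    -- coordinates, so the clash graph can be taken on all vertices.
    x y : V → ℕ
    x v = if inK v then 0 else indeg v
    y v = if inK v then 0 else outdeg v

    x-independent : ∀ {a} → a ∈I → x a ≡ indeg a
    x-independent a∈I rewrite a∈I = refl

    y-independent : ∀ {a} → a ∈I → y a ≡ outdeg a
    y-independent a∈I rewrite a∈I = refl

    indeg≤m : ∀ v → indeg v ≤ m
    indeg≤m v = sum-mono λ d → ⟦⟧-mono {below v d} (proj₁ ∘ ∧-true)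

    outdeg≤m : ∀ v → outdeg v ≤ m
    outdeg≤m v = sum-mono λ d → ⟦⟧-mono {above v d} (proj₁ ∘ ∧-true)

    -- A clique vertex d both below a and above b would give b ⇒ d ⇒ a, an edge between independent
    -- vertices. Since a and b are arbitrary, the largest x can serve as the common separator `t`.
    x+y≤m : ∀ a b → x a + y b ≤ m
    x+y≤m a b with inK a in a∈ | inK b in b∈
    ... | true  | true  = z≤n
    ... | true  | false = outdeg≤m b
    ... | false | true  = subst (_≤ m) (≡.sym (ℕ.+-identityʳ _)) (indeg≤m a)
    ... | false | false = subst (_≤ m) (sum-+ (λ d → ⟦ below a d ⟧) (λ d → ⟦ above b d ⟧)) $
      sum-mono λ d → ⟦⟧-disjoint {below a d} {above b d} (proj₁ ∘ ∧-true) (proj₁ ∘ ∧-true)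
        λ (d∈ , d∈′) → independent b∈ a∈ (⇒-edge (⇒-trans (proj₂ (∧-true {inK d} d∈′)) (proj₂ (∧-true {inK d} d∈))))

    t : ℕ
    t = maximum x

    t+y≤m : ∀ a → t + y a ≤ m
    t+y≤m a = ℕ.m≤o∸n⇒m+n≤o t (ℕ.m+n≤o⇒n≤o (x a) (x+y≤m a a))
      (maximum-≤ x λ b → ℕ.m+n≤o⇒m≤o∸n (x b) (x+y≤m b a))

    ∈I-x : ∀ {v} → 0 < x v → v ∈I
    ∈I-x {v} 0<x with false ← inK v = refl

    ∈I-y : ∀ {v} → 0 < y v → v ∈I
    ∈I-y {v} 0<y with false ← inK v = refl

    pos-injective : ∀ {c d} → c ∈K → d ∈K → indeg c ≡ indeg d → c ≡ d
    pos-injective {c} {d} c∈K d∈K eq with c ≟ d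
    ... | yes p = p
    ... | no ¬p = [ (λ c⇒d → contradiction eq (ℕ.<⇒≢ (⇒⇒indeg< c∈K c⇒d)))
                  , (λ d⇒c → contradiction (≡.sym eq) (ℕ.<⇒≢ (⇒⇒indeg< d∈K d⇒c))) ]′ (⇒-total ¬p c∈K d∈K)

    pos<x : ∀ {c a} → c ∈K → a ∈I → c ⇒ a → indeg c < x a
    pos<x {c} c∈K a∈I c⇒a = subst (indeg c <_) (≡.sym (x-independent a∈I)) (⇒⇒indeg< c∈K c⇒a)

    m≤pos+y : ∀ {c a} → c ∈K → a ∈I → a ⇒ c → m ≤ indeg c + y a
    m≤pos+y {c} c∈K a∈I a⇒c = subst (λ z → m ≤ indeg c + z) (≡.sym (y-independent a∈I)) (⇒⇒m≤ c∈K a⇒c)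

    x≤pos : ∀ {c a} → c ∈K → ¬ c ⇒ a → x a ≤ indeg c
    x≤pos {c} {a} c∈K ¬c⇒a with inK a
    ... | true  = z≤n
    ... | false = ¬⇒⇒indeg≤ c∈K ¬c⇒a

    pos+y<m : ∀ {c a} → c ∈K → ¬ a ⇒ c → indeg c + y a < m
    pos+y<m {c} {a} c∈K ¬a⇒c with inK a
    ... | true  = ℕ.≤-<-trans (ℕ.+-monoʳ-≤ (indeg c) z≤n) (¬⇒⇒<m c∈K ¬a⇒c)
    ... | false = ¬⇒⇒<m c∈K ¬a⇒c

    decide : ∀ u v → Dec (u ⇒ v)
    decide u v = proj₁ comparability u v ≟ᵇ true

    edge⇐ : ∀ {c a} → c ∈K → a ∈I → indeg c < x a ⊎ m ≤ indeg c + y a → Edge G c a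
    edge⇐ {c} {a} c∈K a∈I h with decide c a | decide a c
    ... | yes c⇒a | _       = ⇒-edge c⇒a
    ... | no  _   | yes a⇒c = ≡.trans (sym G c a) (⇒-edge a⇒c)
    ... | no ¬c⇒a | no ¬a⇒c = contradiction h
      [ ℕ.≤⇒≯ (x≤pos c∈K ¬c⇒a) , ℕ.<⇒≱ (pos+y<m c∈K ¬a⇒c) ]′

    x-witness : ∀ {b} → b ∈I → (p : V → Bool) → size p < x b → ∃ λ c → c ∈K × p c ≢ true × indeg c < x b
    x-witness {b} b∈I p lt
      with c , lt′ ← sum-<-witness (subst (size p <_) (x-independent b∈I) lt)
      with c∉p , c∈ ← ⟦⟧-<⁻ {p c} lt′
      with c∈K , c⇒b ← ∧-true c∈
      = c , c∈K , c∉p , pos<x c∈K b∈I c⇒b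

    y-witness : ∀ {b} → b ∈I → (p : V → Bool) → size p < y b → ∃ λ c → c ∈K × p c ≢ true × m ≤ indeg c + y b
    y-witness {b} b∈I p lt
      with c , lt′ ← sum-<-witness (subst (size p <_) (y-independent b∈I) lt)
      with c∉p , c∈ ← ⟦⟧-<⁻ {p c} lt′
      with c∈K , b⇒c ← ∧-true c∈
      = c , c∈K , c∉p , m≤pos+y c∈K b∈I b⇒c

    -- The sets counted by `x` and `y`, including the value 0 on the clique. A strict inequality of
    -- sizes then produces a clique vertex lying in one set and outside the other.
    x-set y-set : V → V → Bool
    x-set v d = if inK v then false else below v d
    y-set v d = if inK v then false else above v d

    size-∅ : ∀ {k} → sum {k} (λ _ → 0) ≡ 0
    size-∅ {zero}  = refl
    size-∅ {suc k} = size-∅ {k}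

    size-x : ∀ v → size (x-set v) ≡ x v
    size-x v with inK v
    ... | true  = size-∅ {n G}
    ... | false = refl

    size-y : ∀ v → size (y-set v) ≡ y v
    size-y v with inK v
    ... | true  = size-∅ {n G}
    ... | false = refl

    ∉x-set : ∀ {c a} → c ∈K → x-set a c ≢ true → x a ≤ indeg c
    ∉x-set {c} {a} c∈K c∉ with inK a
    ... | true  = z≤n
    ... | false = ¬⇒⇒indeg≤ c∈K (c∉ ∘ ∧-intro c∈K)

    ∉y-set : ∀ {c a} → c ∈K → y-set a c ≢ true → indeg c + y a < m
    ∉y-set {c} {a} c∈K c∉ with inK a
    ... | true  = subst (_< m) (≡.sym (ℕ.+-identityʳ _)) (ℕ.m+n≤o⇒m≤o (suc (indeg c)) (¬⇒⇒<m {c} {c} c∈K ⇒-irrefl))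
    ... | false = ¬⇒⇒<m c∈K (c∉ ∘ ∧-intro c∈K)

    x-separate : ∀ {a b} → x a < x b → ∃ λ c → c ∈K × x a ≤ indeg c × indeg c < x b
    x-separate {a} {b} lt
      with c , c∈K , c∉ , c<b ← x-witness (∈I-x (ℕ.≤-<-trans z≤n lt)) (x-set a)
                                  (subst (_< x b) (≡.sym (size-x a)) lt)
      = c , c∈K , ∉x-set {c} {a} c∈K c∉ , c<b

    y-separate : ∀ {a b} → y a < y b → ∃ λ c → c ∈K × indeg c + y a < m × m ≤ indeg c + y b
    y-separate {a} {b} lt
      with c , c∈K , c∉ , c<b ← y-witness (∈I-y (ℕ.≤-<-trans z≤n lt)) (y-set a)
                                  (subst (_< y b) (≡.sym (size-y a)) lt)
      = c , c∈K , ∉y-set {c} {a} c∈K c∉ , c<b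

    x-positive : ∀ {b} → 0 < x b → ∃ λ c → c ∈K × indeg c < x b
    x-positive {b} lt
      with c , c∈K , _ , c<b ← x-witness (∈I-x lt) (λ _ → false) (subst (_< x b) (≡.sym (size-∅ {n G})) lt)
      = c , c∈K , c<b

    y-positive : ∀ {b} → 0 < y b → ∃ λ c → c ∈K × m ≤ indeg c + y b
    y-positive {b} lt
      with c , c∈K , _ , c<b ← y-witness (∈I-y lt) (λ _ → false) (subst (_< y b) (≡.sym (size-∅ {n G})) lt)
      = c , c∈K , c<b

  coordinates : Coordinates G
  coordinates = record
    { inK = inK ; m = m ; t = t ; pos = indeg ; x = x ; y = y
    ; clique = clique
    ; independent = independent
    ; pos<m = λ {c} c∈K → ℕ.m+n≤o⇒m≤o (suc (indeg c)) (¬⇒⇒<m {c} {c} c∈K ⇒-irrefl)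
    ; pos-injective = pos-injective
    ; x≤t = ≤-maximum x
    ; t+y≤m = t+y≤m
    ; edge⇒ = λ c∈K a∈I e → [ inj₁ ∘ pos<x c∈K a∈I , inj₂ ∘ m≤pos+y c∈K a∈I ]′ (edge-⇒ e)
    ; edge⇐ = edge⇐
    ; x-clique = λ {c} c∈K → cong (if_then 0 else indeg c) c∈K
    ; y-clique = λ {c} c∈K → cong (if_then 0 else outdeg c) c∈K
    ; x-positive = x-positive
    ; y-positive = y-positive
    ; x-separate = x-separate
    ; y-separate = y-separate
    }

-- Two-colouring the clash graph.

module Points {k : ℕ} (x y : Fin k → ℕ) where

  infix 4 _◁_
  _◁_ : Fin k → Fin k → Set
  a ◁ b = x a < x b × y b < y a

  _◁?_ : ∀ a b → Dec (a ◁ b)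
  a ◁? b = (x a ℕ.<? x b) ×-dec (y b ℕ.<? y a)

  -- The intervals [-y a, x a] and [-y b, x b] cross.
  Clash : Fin k → Fin k → Set
  Clash a b = a ◁ b × (0 < x a ⊎ 0 < y b)

  ProperColouring : Set
  ProperColouring = Σ (Fin k → Bool) λ col → ∀ {a b} → Clash a b → col a ≢ col b

  -- What is left once chains leading to `F₀` are excluded: no chain of three has all three of its
  -- pairs clashing.
  ChainsSpanAxes : Set
  ChainsSpanAxes = ∀ {a b c} → a ◁ b → b ◁ c → x a ≡ 0 × y c ≡ 0

  -- For v off the axes, `HitX v` and `HitY v` say that v clashes with a point of the x-axis or of
  -- the y-axis respectively.
  HitX HitY : Fin k → Set
  HitX v = ∃ λ b → y b ≡ 0 × x v < x b
  HitY v = ∃ λ a → x a ≡ 0 × y v < y a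

  hitX? : ∀ v → Dec (HitX v)
  hitX? v = Fin.any? λ b → (y b ℕ.≟ 0) ×-dec (x v ℕ.<? x b)

  hitY? : ∀ v → Dec (HitY v)
  hitY? v = Fin.any? λ a → (x a ℕ.≟ 0) ×-dec (y v ℕ.<? y a)

  OnlyX : Fin k → Set
  OnlyX v = 0 < x v × 0 < y v × HitX v × ¬ HitY v

  OnlyY : Fin k → Set
  OnlyY v = 0 < x v × 0 < y v × HitY v × ¬ HitX v

  onlyX? : ∀ v → Dec (OnlyX v)
  onlyX? v = (0 ℕ.<? x v) ×-dec (0 ℕ.<? y v) ×-dec hitX? v ×-dec ¬? (hitY? v)

  colour-chainless : (∀ {a b c} → a ◁ b → ¬ b ◁ c) → ProperColouring
  colour-chainless chainless = (λ v → does (hasPred? v)) , proper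
    where
    hasPred? : ∀ v → Dec (∃ λ u → u ◁ v)
    hasPred? v = Fin.any? λ u → u ◁? v
    proper : ∀ {a b} → Clash a b → does (hasPred? a) ≢ does (hasPred? b)
    proper {a} {b} (a◁b , _) eq = contradiction
      (≡.trans (≡.sym (dec-false (hasPred? a) λ (_ , u◁a) → chainless u◁a a◁b))
        (≡.trans eq (dec-true (hasPred? b) (a , a◁b)))) λ ()

  -- Points on the axes get one colour, which forces the other colour on every point they clash with.
  colour-without-OnlyX : ChainsSpanAxes → (∀ v → ¬ OnlyX v) → ProperColouring
  colour-without-OnlyX axes noOnlyX = (λ v → does (colour? v)) , proper
    where
    -- The last clause extends the axis colour to points off the axes: it selects the left end of a
    -- clash between two such points, unless a clash with the y-axis already forces the other
    -- colour.
    Colour : Fin k → Set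
    Colour v = x v ≡ 0 ⊎ y v ≡ 0 ⊎ (¬ HitY v × ∃ λ w → v ◁ w × 0 < y w)

    colour? : ∀ v → Dec (Colour v)
    colour? v = (x v ℕ.≟ 0) ⊎-dec (y v ℕ.≟ 0) ⊎-dec
      (¬? (hitY? v) ×-dec Fin.any? λ w → (v ◁? w) ×-dec (0 ℕ.<? y w))

    distinct : ∀ {a b} → Colour a → ¬ Colour b → does (colour? a) ≢ does (colour? b)
    distinct {a} {b} ca ¬cb eq = contradiction
      (≡.trans (≡.sym (dec-true (colour? a) ca)) (≡.trans eq (dec-false (colour? b) ¬cb))) λ ()

    hitX⇒hitY : ∀ {v} → 0 < x v → 0 < y v → HitX v → HitY v
    hitX⇒hitY {v} 0<x 0<y hit with hitY? v
    ... | yes h = h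
    ... | no ¬h = contradiction (0<x , 0<y , hit , ¬h) (noOnlyX v)

    hit-uncoloured : ∀ {v} → 0 < x v → 0 < y v → HitY v → ¬ Colour v
    hit-uncoloured 0<x 0<y hit = [ ℕ.m<n⇒n≢0 0<x , [ ℕ.m<n⇒n≢0 0<y , (λ (¬hit , _) → ¬hit hit) ]′ ]′

    proper : ∀ {a b} → Clash a b → does (colour? a) ≢ does (colour? b)
    proper {a} {b} (a◁b@(xa<xb , yb<ya) , off) with x a ℕ.≟ 0 | y b ℕ.≟ 0
    ... | yes xa≡0 | _ = distinct (inj₁ xa≡0)
      (hit-uncoloured (ℕ.≤-<-trans z≤n xa<xb)
        0<yb (a , xa≡0 , yb<ya))
      where
      0<yb : 0 < y b
      0<yb = [ (λ 0<xa → contradiction xa≡0 (ℕ.m<n⇒n≢0 0<xa)) , (λ 0<yb → 0<yb) ]′ off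
    ... | no xa≢0 | yes yb≡0 = distinct {b} {a} (inj₂ (inj₁ yb≡0))
      (hit-uncoloured (ℕ.n≢0⇒n>0 xa≢0) 0<ya (hitX⇒hitY (ℕ.n≢0⇒n>0 xa≢0) 0<ya (b , yb≡0 , xa<xb))) ∘ ≡.sym
      where
      0<ya : 0 < y a
      0<ya = ℕ.≤-<-trans z≤n yb<ya
    -- Both points are off the axes. A hit u on the y-axis would make u ◁ a ◁ b a chain with 0 < y
    -- b, so a is coloured; the last clause for b would make a ◁ b ◁ w a chain with 0 < y w, so b is
    -- not.
    ... | no xa≢0 | no yb≢0 = distinct
      (inj₂ (inj₂ ((λ (_ , xu≡0 , ya<yu) → yb≢0
                      (proj₂ (axes (subst (_< x a) (≡.sym xu≡0) (ℕ.n≢0⇒n>0 xa≢0) , ya<yu) a◁b)))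
                  , b , a◁b , ℕ.n≢0⇒n>0 yb≢0)))
      [ ℕ.m<n⇒n≢0 (ℕ.≤-<-trans z≤n xa<xb)
      , [ yb≢0 , (λ (_ , w , b◁w , 0<yw) → contradiction (proj₂ (axes a◁b b◁w)) (ℕ.m<n⇒n≢0 0<yw)) ]′ ]′

module _ {k : ℕ} {x y : Fin k → ℕ} where
  private
    module P = Points x y
    module Q = Points y x
  open Points x y

  -- Exchanging the coordinates reverses `◁` and turns `OnlyY` into `OnlyX`.
  colour-without-OnlyY : ChainsSpanAxes → (∀ v → ¬ OnlyY v) → ProperColouring
  colour-without-OnlyY axes noOnlyY = col , λ (a◁b , off) → proper (×-swap a◁b , ⊎-swap off) ∘ ≡.sym
    where
    swapped : Q.ProperColouring
    swapped = Q.colour-without-OnlyX (λ a◁b b◁c → ×-swap (axes (×-swap b◁c) (×-swap a◁b)))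
      λ v (0<y , 0<x , rest) → noOnlyY v (0<x , 0<y , rest)
    col = proj₁ swapped
    proper = proj₂ swapped

  -- The 5-cycle of clashes is a₁, a₂, a₃, b₂, b₁. The fields `a₂<b₁` and `a₂<b₂` allow a single
  -- clique vertex to separate a₂, b₂ from a₃, b₁ by x, and another to separate a₂, b₁ from a₁, b₂
  -- by y.
  record Obstruction : Set where
    field
      {a₁ a₂ a₃ b₁ b₂} : Fin k
      x-a₁  : x a₁ ≡ 0
      y-a₃  : y a₃ ≡ 0
      a₁◁a₂ : a₁ ◁ a₂
      a₂◁a₃ : a₂ ◁ a₃
      b₂◁b₁ : b₂ ◁ b₁
      x-b₂  : 0 < x b₂
      y-b₁  : 0 < y b₁
      a₂<b₁ : x a₂ < x b₁
      b₂<a₃ : x b₂ < x a₃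
      a₂<b₂ : y a₂ < y b₂
      b₁<a₁ : y b₁ < y a₁

  -- A chain p ◁ q ◁ r makes q clash with both of its ends, so one point on each axis must share a
  -- colour. Points g in `OnlyX` and h in `OnlyY` satisfy g ◁ h and thus clash, while g clashes with
  -- the x-axis and h with the y-axis; this closes an odd cycle.
  Colourable⊎Obstructed : ChainsSpanAxes → Obstruction ⊎ ProperColouring
  Colourable⊎Obstructed axes with Fin.any? (λ a → Fin.any? (λ b → Fin.any? (λ c → (a ◁? b) ×-dec (b ◁? c))))
  ... | no ¬chain = inj₂ (colour-chainless λ {a} {b} {c} a◁b b◁c → ¬chain (a , b , c , a◁b , b◁c))
  ... | yes (p , q , r , p◁q , q◁r) with Fin.any? P.onlyX? | Fin.any? Q.onlyX?
  ...   | no ¬g | _ = inj₂ (colour-without-OnlyX axes λ v g → ¬g (v , g))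
  ...   | yes _ | no ¬h = inj₂ (colour-without-OnlyY axes λ v (0<x , 0<y , rest) → ¬h (v , 0<y , 0<x , rest))
  ...   | yes (g , 0<xg , 0<yg , (b , yb≡0 , xg<xb) , ¬hitY-g)
        | yes (h , 0<yh , 0<xh , (a , xa≡0 , yh<ya) , ¬hitX-h) =
    -- The chain and the hits may involve different points of an axis; an extreme one of the two can
    -- replace both.
    inj₁ (obstruction (highest p a xp≡0 xa≡0) (widest r b yr≡0 yb≡0))
    where
    xp≡0 : x p ≡ 0
    xp≡0 = proj₁ (axes p◁q q◁r)
    yr≡0 : y r ≡ 0
    yr≡0 = proj₂ (axes p◁q q◁r)
    highest : ∀ u v → x u ≡ 0 → x v ≡ 0 → ∃ λ w → x w ≡ 0 × y u ≤ y w × y v ≤ y w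
    highest u v xu≡0 xv≡0 with ℕ.≤-total (y u) (y v)
    ... | inj₁ yu≤yv = v , xv≡0 , yu≤yv , ℕ.≤-refl
    ... | inj₂ yv≤yu = u , xu≡0 , ℕ.≤-refl , yv≤yu
    widest : ∀ u v → y u ≡ 0 → y v ≡ 0 → ∃ λ w → y w ≡ 0 × x u ≤ x w × x v ≤ x w
    widest u v yu≡0 yv≡0 with ℕ.≤-total (x u) (x v)
    ... | inj₁ xu≤xv = v , yv≡0 , xu≤xv , ℕ.≤-refl
    ... | inj₂ xv≤xu = u , yu≡0 , ℕ.≤-refl , xv≤xu
    x≤xh : ∀ {v} → y v ≡ 0 → x v ≤ x h
    x≤xh {v} yv≡0 = ℕ.≮⇒≥ λ lt → ¬hitX-h (v , yv≡0 , lt)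
    y≤yg : ∀ {v} → x v ≡ 0 → y v ≤ y g
    y≤yg {v} xv≡0 = ℕ.≮⇒≥ λ lt → ¬hitY-g (v , xv≡0 , lt)
    obstruction : (∃ λ w → x w ≡ 0 × y p ≤ y w × y a ≤ y w) →
                  (∃ λ w → y w ≡ 0 × x r ≤ x w × x b ≤ x w) → Obstruction
    obstruction (a₁ , x₁≡0 , yp≤y₁ , ya≤y₁) (a₃ , y₃≡0 , xr≤x₃ , xb≤x₃) = record
      { x-a₁  = x₁≡0
      ; y-a₃  = y₃≡0
      ; a₁◁a₂ = subst (_< x q) (≡.sym x₁≡0) (ℕ.≤-<-trans z≤n (proj₁ p◁q)) , ℕ.<-≤-trans (proj₂ p◁q) yp≤y₁
      ; a₂◁a₃ = ℕ.<-≤-trans (proj₁ q◁r) xr≤x₃ , subst (_< y q) (≡.sym y₃≡0) (ℕ.≤-<-trans z≤n (proj₂ q◁r))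
      ; b₂◁b₁ = ℕ.<-≤-trans xg<xb (x≤xh yb≡0) , ℕ.<-≤-trans yh<ya (y≤yg xa≡0)
      ; x-b₂  = 0<xg
      ; y-b₁  = 0<yh
      ; a₂<b₁ = ℕ.<-≤-trans (proj₁ q◁r) (x≤xh yr≡0)
      ; b₂<a₃ = ℕ.<-≤-trans xg<xb xb≤x₃
      ; a₂<b₂ = ℕ.<-≤-trans (proj₂ p◁q) (y≤yg xp≡0)
      ; b₁<a₁ = ℕ.<-≤-trans yh<ya ya≤y₁
      }

-- A 2-uniform word from chords on a cut-open circle.

-- Points 0, 1, 2, … on a line, gap g lying just before point g.  A clique vertex is a chord between the
-- points lo and hi, an independent vertex one between the gaps lo and hi.  Within a gap the ends of the
-- chords ending there precede the ends of those starting there, and longer chords enclose shorter ones.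
module Layout (G : Graph) (inK : Fin (n G) → Bool) (lo hi : Fin (n G) → ℕ) (M : ℕ) (hi≤M : ∀ v → hi v ≤ M) where

  N B : ℕ
  N = n G
  B = M * N + N

  rank : Fin (n G) → ℕ
  rank v = (hi v ∸ lo v) * N + toℕ v

  -- The factor 3 gives each g three slots: 3g for chords ending in gap g, 3g + 1 for those starting
  -- there, 3g + 2 for the point g. Inside a slot, `rank` is added at ends and subtracted from `B`
  -- at starts.
  startGap endGap start end : Fin (n G) → ℕ
  startGap v = if inK v then 2 + 3 * lo v else 1 + 3 * lo v
  endGap v   = if inK v then 2 + 3 * hi v else 3 * hi v
  start v    = startGap v * suc B + (B ∸ rank v)
  end v      = endGap v * suc B + rank v

  open ChordDiagram start end public

  private
    rank≤B : ∀ v → rank v ≤ B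
    rank≤B v = ℕ.+-mono-≤ (ℕ.*-monoˡ-≤ N (ℕ.≤-trans (ℕ.m∸n≤m (hi v) (lo v)) (hi≤M v))) (ℕ.<⇒≤ (Fin.toℕ<n v))

    start<start : ∀ u v → startGap u < startGap v → start u < start v
    start<start u v p = lex-< p (s≤s (ℕ.m∸n≤m B (rank u)))

    start<end : ∀ u v → startGap u < endGap v → start u < end v
    start<end u v p = lex-< p (s≤s (ℕ.m∸n≤m B (rank u)))

    end<start : ∀ u v → endGap u < startGap v → end u < start v
    end<start u v p = lex-< p (s≤s (rank≤B u))

    end<end : ∀ u v → endGap u < endGap v → end u < end v
    end<end u v p = lex-< p (s≤s (rank≤B u))

    before : ∀ {p g} → p < g → 2 + 3 * p < 3 * g
    before {p} p<g = ℕ.≤-trans (ℕ.≤-reflexive (≡.sym (ℕ.*-suc 3 p))) (ℕ.*-monoʳ-≤ 3 p<g)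

    before′ : ∀ {p g} → p < g → 2 + 3 * p < 1 + 3 * g
    before′ p<g = ℕ.m≤n⇒m≤1+n (before p<g)

    after : ∀ {p g} → g ≤ p → 3 * g < 2 + 3 * p
    after g≤p = s≤s (ℕ.m≤n⇒m≤1+n (ℕ.*-monoʳ-≤ 3 g≤p))

    after′ : ∀ {p g} → g ≤ p → 1 + 3 * g < 2 + 3 * p
    after′ g≤p = s≤s (s≤s (ℕ.*-monoʳ-≤ 3 g≤p))

    point : ∀ {p q} → p < q → 2 + 3 * p < 2 + 3 * q
    point p<q = ℕ.+-monoʳ-< 2 (ℕ.*-monoʳ-< 3 p<q)

  clique-alternate : ∀ {c d} → inK c ≡ true → inK d ≡ true → lo c < lo d → lo d < hi c → hi c < hi d →
                     Alternate word c d
  clique-alternate {c} {d} c∈K d∈K p q r =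
    interlaced⇒alternate {c} {d} (start<start c d p′) (start<end d c q′) (end<end c d r′)
    where
    p′ : startGap c < startGap d
    p′ rewrite c∈K | d∈K = point p
    q′ : startGap d < endGap c
    q′ rewrite c∈K | d∈K = point q
    r′ : endGap c < endGap d
    r′ rewrite c∈K | d∈K = point r

  module _ {c a : Fin (n G)} (c∈K : inK c ≡ true) (a∉K : inK a ≡ false) where

    private
      lo-lo : lo c < lo a → start c < start a
      lo-lo p = start<start c a q
        where
        q : startGap c < startGap a
        q rewrite c∈K | a∉K = before′ p

      lo≥lo : lo a ≤ lo c → start a < start c
      lo≥lo p = start<start a c q
        where
        q : startGap a < startGap c
        q rewrite c∈K | a∉K = after′ p

      lo-hi : lo c < hi a → start c < end a
      lo-hi p = start<end c a q
        where
        q : startGap c < endGap a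
        q rewrite c∈K | a∉K = before p

      lo≥hi : hi a ≤ lo c → end a < start c
      lo≥hi p = end<start a c q
        where
        q : endGap a < startGap c
        q rewrite c∈K | a∉K = after p

      hi-lo : hi c < lo a → end c < start a
      hi-lo p = end<start c a q
        where
        q : endGap c < startGap a
        q rewrite c∈K | a∉K = before′ p

      hi≥lo : lo a ≤ hi c → start a < end c
      hi≥lo p = start<end a c q
        where
        q : startGap a < endGap c
        q rewrite c∈K | a∉K = after′ p

      hi-hi : hi c < hi a → end c < end a
      hi-hi p = end<end c a q
        where
        q : endGap c < endGap a
        q rewrite c∈K | a∉K = before p

      hi≥hi : hi a ≤ hi c → end a < end c
      hi≥hi p = end<end a c q
        where
        q : endGap a < endGap c
        q rewrite c∈K | a∉K = after p

      own : lo a < hi a → start a < end a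
      own p = start<end a a q
        where
        q : startGap a < endGap a
        q rewrite a∉K = ℕ.≤-trans (ℕ.n≤1+n _) (before p)

      ownK : lo c < hi c → start c < end c
      ownK p = start<end c c q
        where
        q : startGap c < endGap c
        q rewrite c∈K = point p

    -- The name spells the order of the four ends from left to right.
    caca : lo c < lo a → lo a ≤ hi c → hi c < hi a → Alternate word c a
    caca p q r = interlaced⇒alternate {c} {a} (lo-lo p) (hi≥lo q) (hi-hi r)

    acac : lo a ≤ lo c → lo c < hi a → hi a ≤ hi c → Alternate word c a
    acac p q r = subst NoTwoConsecutiveEqual (restrict-comm word a c)
      (interlaced⇒alternate {a} {c} (lo≥lo p) (lo-hi q) (hi≥hi r))

    caac : lo c < lo a → lo a < hi a → hi a ≤ hi c → ¬ Alternate word c a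
    caac p q r = nested⇒¬alternate {c} {a} (lo-lo p) (own q) (hi≥hi r)

    aacc : lo a < hi a → hi a ≤ lo c → lo c < hi c → ¬ Alternate word c a
    aacc p q r = disjoint⇒¬alternate {a} {c} (own p) (lo≥hi q) (ownK r)
      ∘ subst NoTwoConsecutiveEqual (restrict-comm word c a)

    ccaa : lo c < hi c → hi c < lo a → lo a < hi a → ¬ Alternate word c a
    ccaa p q r = disjoint⇒¬alternate {c} {a} (ownK p) (hi-lo q) (own r)

  module _ {a b : Fin (n G)} (a∉K : inK a ≡ false) (b∉K : inK b ≡ false) (lo<hi : lo a < hi a) where

    private
      own : start a < end a
      own = start<end a a q
        where
        q : startGap a < endGap a
        q rewrite a∉K = ℕ.≤-trans (ℕ.n≤1+n _) (before lo<hi)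

    apart : lo b < hi b → hi a ≤ lo b → ¬ Alternate word a b
    apart lo<hi′ p = disjoint⇒¬alternate {a} {b} own (end<start a b q) (start<end b b r)
      where
      q : endGap a < startGap b
      q rewrite a∉K | b∉K = s≤s (ℕ.*-monoʳ-≤ 3 p)
      r : startGap b < endGap b
      r rewrite b∉K = ℕ.≤-trans (ℕ.n≤1+n _) (before lo<hi′)

    inside-< : lo b ≤ lo a → hi a ≤ hi b → rank a < rank b → ¬ Alternate word a b
    inside-< p q r = nested⇒¬alternate {b} {a} start< own end<
      ∘ subst NoTwoConsecutiveEqual (restrict-comm word a b)
      where
      start< : start b < start a
      start< rewrite a∉K | b∉K =
        ℕ.+-mono-≤-< (ℕ.*-monoˡ-≤ (suc B) (s≤s (ℕ.*-monoʳ-≤ 3 p))) (ℕ.∸-monoʳ-< r (rank≤B b))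
      end< : end a < end b
      end< rewrite a∉K | b∉K = ℕ.+-mono-≤-< (ℕ.*-monoˡ-≤ (suc B) (ℕ.*-monoʳ-≤ 3 q)) r

  -- If one containment is strict, the outer interval is longer and so has the larger rank. If the
  -- intervals coincide, the indices decide which chord is the inner one.
  inside : ∀ {a b} → a ≢ b → inK a ≡ false → inK b ≡ false → lo a < hi a → lo b ≤ lo a → hi a ≤ hi b →
           ¬ Alternate word a b
  inside {a} {b} a≢b a∉K b∉K lo<hi p q with ℕ.m≤n⇒m<n∨m≡n p | ℕ.m≤n⇒m<n∨m≡n q
  ... | inj₁ p< | _ = inside-< a∉K b∉K lo<hi p q
    (lex-< (ℕ.≤-<-trans (ℕ.∸-monoˡ-≤ (lo a) q) (ℕ.∸-monoʳ-< p< (ℕ.≤-trans (ℕ.<⇒≤ lo<hi) q))) (Fin.toℕ<n a))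
  ... | inj₂ _  | inj₁ q< = inside-< a∉K b∉K lo<hi p q
    (lex-< (ℕ.<-≤-trans (ℕ.∸-monoˡ-< q< (ℕ.<⇒≤ lo<hi)) (ℕ.∸-monoʳ-≤ (hi b) p)) (Fin.toℕ<n a))
  ... | inj₂ p≡ | inj₂ q≡ =
    [ (λ a<b → inside-< a∉K b∉K lo<hi p q (rank< {a} {b} p≡ q≡ a<b))
    , (λ b<a → inside-< b∉K a∉K (subst₂ _<_ (≡.sym p≡) q≡ lo<hi)
                 (ℕ.≤-reflexive (≡.sym p≡)) (ℕ.≤-reflexive (≡.sym q≡))
                 (rank< {b} {a} (≡.sym p≡) (≡.sym q≡) b<a)
             ∘ subst NoTwoConsecutiveEqual (restrict-comm word a b)) ]′ (toℕ≷ a≢b)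
    where
    rank< : ∀ {u v} → lo v ≡ lo u → hi u ≡ hi v → toℕ u < toℕ v → rank u < rank v
    rank< {u} lo≡ hi≡ u<v rewrite lo≡ | hi≡ = ℕ.+-monoʳ-< _ u<v

-- On a circle with 2m points, where p and p + m are the ends of the same clique chord, both intervals
-- [m - y a, m + x a] and [2m - y a, 2m + x a] cut off the neighbours of a.  The colouring tells which of
-- them to use; chords of opposite colours are disjoint.  The circle is cut open at the point t.
module TwoUniform {G : Graph} (C : Coordinates G)
                  (colouring : Points.ProperColouring (Coordinates.x C) (Coordinates.y C)) where
  open Coordinates C
  open Points x y using (_◁_; Clash)

  private
    V : Set
    V = Fin (n G)

    col : V → Bool
    col = proj₁ colouring

  centre : V → ℕ
  centre a = if col a then m else m + m

  isolated? : ∀ a → Dec (x a ≡ 0 × y a ≡ 0)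
  isolated? a = (x a ℕ.≟ 0) ×-dec (y a ℕ.≟ 0)

  -- The cut at t severs no interval. From x ≤ t and t + y ≤ m, intervals at the first centre lie in
  -- [t, m + t] and those at the second in [m + t, 2m + t]. Clique points p < t are moved to 2m + p,
  -- which makes m + p the lower end of their chord.
  cliqueLo : V → ℕ
  cliqueLo c = if does (pos c ℕ.<? t) then m + pos c else pos c

  -- With x a = y a = 0 the interval at the centre would be degenerate, and its chord would end
  -- before it starts. Such vertices share [3m, 3m + 1] instead, to the right of everything else,
  -- since all other ends are at most 3m.
  lo hi : V → ℕ
  lo v = if inK v then cliqueLo v else
         if does (isolated? v) then m + m + m else centre v ∸ y v
  hi v = if inK v then m + cliqueLo v else
         if does (isolated? v) then suc (m + m + m) else centre v + x v

  data CliquePlace (c : V) : Set where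
    left  : pos c < t → lo c ≡ m + pos c → hi c ≡ m + m + pos c → CliquePlace c
    right : t ≤ pos c → lo c ≡ pos c → hi c ≡ m + pos c → CliquePlace c

  hi-clique : ∀ {c} → inK c ≡ true → hi c ≡ m + lo c
  hi-clique c∈K rewrite c∈K = refl

  cliquePlace : ∀ {c} → inK c ≡ true → CliquePlace c
  cliquePlace {c} c∈K with pos c ℕ.<? t
  ... | yes p = left p lo≡ hi≡
    where
    lo≡ : lo c ≡ m + pos c
    lo≡ rewrite c∈K | dec-true (pos c ℕ.<? t) p = refl
    hi≡ : hi c ≡ m + m + pos c
    hi≡ = ≡.trans (hi-clique c∈K) (≡.trans (cong (m +_) lo≡) (≡.sym (ℕ.+-assoc m m (pos c))))
  ... | no ¬p = right (ℕ.≮⇒≥ ¬p) lo≡ hi≡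
    where
    lo≡ : lo c ≡ pos c
    lo≡ rewrite c∈K | dec-false (pos c ℕ.<? t) ¬p = refl
    hi≡ : hi c ≡ m + pos c
    hi≡ = ≡.trans (hi-clique c∈K) (cong (m +_) lo≡)

  data Place (a : V) : Set where
    isolated : x a ≡ 0 → y a ≡ 0 → lo a ≡ m + m + m → hi a ≡ suc (m + m + m) → Place a
    coloured : 0 < y a ⊎ 0 < x a → lo a + y a ≡ centre a → hi a ≡ centre a + x a → Place a

  centre-true : ∀ {a} → col a ≡ true → centre a ≡ m
  centre-true e = cong (if_then m else m + m) e

  centre-false : ∀ {a} → col a ≡ false → centre a ≡ m + m
  centre-false e = cong (if_then m else m + m) e

  centre-cases : ∀ a → centre a ≡ m ⊎ centre a ≡ m + m
  centre-cases a with col a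
  ... | true  = inj₁ refl
  ... | false = inj₂ refl

  m≤centre : ∀ a → m ≤ centre a
  m≤centre a with col a
  ... | true  = ℕ.≤-refl
  ... | false = ℕ.m≤m+n m m

  place : ∀ {a} → inK a ≡ false → Place a
  place {a} a∉K with isolated? a
  ... | yes p = isolated (proj₁ p) (proj₂ p) lo≡ hi≡
    where
    lo≡ : lo a ≡ m + m + m
    lo≡ rewrite a∉K | dec-true (isolated? a) p = refl
    hi≡ : hi a ≡ suc (m + m + m)
    hi≡ rewrite a∉K | dec-true (isolated? a) p = refl
  ... | no ¬p = coloured positive lo≡ hi≡
    where
    positive : 0 < y a ⊎ 0 < x a
    positive with y a ℕ.≟ 0
    ... | yes y≡0 = inj₂ (ℕ.n≢0⇒n>0 λ x≡0 → ¬p (x≡0 , y≡0))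
    ... | no  y≢0 = inj₁ (ℕ.n≢0⇒n>0 y≢0)
    lo≡ : lo a + y a ≡ centre a
    lo≡ rewrite a∉K | dec-false (isolated? a) ¬p = ℕ.m∸n+n≡m (ℕ.≤-trans (y≤m a) (m≤centre a))
    hi≡ : hi a ≡ centre a + x a
    hi≡ rewrite a∉K | dec-false (isolated? a) ¬p = refl

  lo<hi : ∀ {a} → inK a ≡ false → lo a < hi a
  lo<hi {a} a∉K with place a∉K
  ... | isolated _ _ lo≡ hi≡ = ℕ.≤-reflexive (≡.trans (cong suc lo≡) (≡.sym hi≡))
  ... | coloured (inj₁ 0<y) lo≡ hi≡ = begin-strict
    lo a            <⟨ ℕ.m<m+n (lo a) 0<y ⟩
    lo a + y a      ≡⟨ lo≡ ⟩
    centre a        ≤⟨ ℕ.m≤m+n (centre a) (x a) ⟩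
    centre a + x a  ≡⟨ hi≡ ⟨
    hi a            ∎
    where open ℕ.≤-Reasoning
  ... | coloured (inj₂ 0<x) lo≡ hi≡ = begin-strict
    lo a            ≤⟨ ℕ.m≤m+n (lo a) (y a) ⟩
    lo a + y a      ≡⟨ lo≡ ⟩
    centre a        <⟨ ℕ.m<m+n (centre a) 0<x ⟩
    centre a + x a  ≡⟨ hi≡ ⟨
    hi a            ∎
    where open ℕ.≤-Reasoning

  open Layout G inK lo hi (maximum hi) (≤-maximum hi) public
    using (word; count-word; clique-alternate; caca; acac; caac; aacc; ccaa; apart; inside)

  private
    t≤m : Fin (n G) → t ≤ m
    t≤m a = ℕ.m+n≤o⇒m≤o t (t+y≤m a)

    lo<m+t : ∀ {c} → inK c ≡ true → lo c < m + t
    lo<m+t {c} c∈K with cliquePlace c∈K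
    ... | left p lo≡ _ = subst (_< m + t) (≡.sym lo≡) (ℕ.+-monoʳ-< m p)
    ... | right _ lo≡ _ = subst (_< m + t) (≡.sym lo≡) (ℕ.<-≤-trans (pos<m c∈K) (ℕ.m≤m+n m t))

    t≤lo : ∀ {c} → inK c ≡ true → t ≤ lo c
    t≤lo {c} c∈K with cliquePlace c∈K
    ... | left _ lo≡ _ = subst (t ≤_) (≡.sym lo≡) (ℕ.≤-trans (t≤m c) (ℕ.m≤m+n m (pos c)))
    ... | right p lo≡ _ = subst (t ≤_) (≡.sym lo≡) p

    lo<hi-clique : ∀ {c} → inK c ≡ true → lo c < hi c
    lo<hi-clique {c} c∈K = subst (lo c <_) (≡.sym (hi-clique c∈K)) (ℕ.m<n+m (lo c) (ℕ.≤-<-trans z≤n (pos<m c∈K)))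

    lo≷ : ∀ {c d} → c ≢ d → inK c ≡ true → inK d ≡ true → lo c < lo d ⊎ lo d < lo c
    lo≷ {c} {d} c≢d c∈K d∈K with ℕ.<-cmp (lo c) (lo d)
    ... | tri< p _ _ = inj₁ p
    ... | tri> _ _ p = inj₂ p
    ... | tri≈ _ p _ with cliquePlace c∈K | cliquePlace d∈K
    ...   | left _ e _  | left _ f _  =
      contradiction (pos-injective c∈K d∈K (ℕ.+-cancelˡ-≡ m _ _ (≡.trans (≡.sym e) (≡.trans p f)))) c≢d
    ...   | right _ e _ | right _ f _ =
      contradiction (pos-injective c∈K d∈K (≡.trans (≡.sym e) (≡.trans p f))) c≢d
    ...   | left _ e _  | right _ f _ =
      contradiction (≡.trans (≡.sym e) (≡.trans p f)) (ℕ.>⇒≢ (ℕ.<-≤-trans (pos<m d∈K) (ℕ.m≤m+n m _)))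
    ...   | right _ e _ | left _ f _  =
      contradiction (≡.trans (≡.sym e) (≡.trans p f)) (ℕ.<⇒≢ (ℕ.<-≤-trans (pos<m c∈K) (ℕ.m≤m+n m _)))

  clique-agrees : ∀ {c d} → inK c ≡ true → inK d ≡ true → lo c < lo d → Agrees G word c d
  clique-agrees {c} {d} c∈K d∈K p = inj₁ (clique (λ { refl → ℕ.<-irrefl refl p }) c∈K d∈K ,
    clique-alternate c∈K d∈K p
      (ℕ.<-≤-trans (lo<m+t d∈K) (subst (m + t ≤_) (≡.sym (hi-clique c∈K))
        (ℕ.+-monoʳ-≤ m (t≤lo c∈K))))
      (subst₂ _<_ (≡.sym (hi-clique c∈K)) (≡.sym (hi-clique d∈K)) (ℕ.+-monoʳ-< m p)))

  low-nonneighbour : ∀ {c a} → inK c ≡ true → inK a ≡ false → pos c < t → x a ≤ pos c → ¬ Edge G c a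
  low-nonneighbour {c} {a} c∈K a∉K p q e = [ ℕ.≤⇒≯ q , ℕ.<⇒≱ (ℕ.<-≤-trans (ℕ.+-monoˡ-< (y a) p) (t+y≤m a)) ]′
    (edge⇒ c∈K a∉K e)

  high-nonneighbour : ∀ {c a} → inK c ≡ true → inK a ≡ false → t ≤ pos c → pos c + y a < m → ¬ Edge G c a
  high-nonneighbour {c} {a} c∈K a∉K p q e = [ ℕ.≤⇒≯ (ℕ.≤-trans (x≤t a) p) , ℕ.<⇒≱ q ]′ (edge⇒ c∈K a∉K e)

  private
    ends-< : ∀ {p q u v} → p ≡ u → q ≡ v → u < v → p < q
    ends-< refl refl u<v = u<v

    ends-≤ : ∀ {p q u v} → p ≡ u → q ≡ v → u ≤ v → p ≤ q
    ends-≤ refl refl u≤v = u≤v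

    <-lo : ∀ {a p u c} → lo a + y a ≡ c → p ≡ u → u + y a < c → p < lo a
    <-lo {a} lo≡ refl lt = ℕ.+-cancelʳ-< (y a) _ (lo a) (subst (_ <_) (≡.sym lo≡) lt)

    lo-≤ : ∀ {a p u c} → lo a + y a ≡ c → p ≡ u → c ≤ u + y a → lo a ≤ p
    lo-≤ {a} lo≡ refl le = ℕ.+-cancelʳ-≤ (y a) (lo a) _ (subst (_≤ _) (≡.sym lo≡) le)

    x≤m : ∀ a → x a ≤ m
    x≤m a = ℕ.≤-trans (x≤t a) (t≤m a)

    pos+y<m : ∀ {c} a → pos c < t → pos c + y a < m
    pos+y<m a p = ℕ.<-≤-trans (ℕ.+-monoˡ-< (y a) p) (t+y≤m a)

    m+-< : ∀ u v → u + v < m → m + u + v < m + m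
    m+-< u v lt = subst (_< m + m) (≡.sym (ℕ.+-assoc m u v)) (ℕ.+-monoʳ-< m lt)

    m+-≤ : ∀ u v → m ≤ u + v → m + m ≤ m + u + v
    m+-≤ u v le = subst (m + m ≤_) (≡.sym (ℕ.+-assoc m u v)) (ℕ.+-monoʳ-≤ m le)

  -- Every clique chord has exactly one end in the window from t up to, but excluding, m + t, namely
  -- its lower end. So it crosses the chord of a exactly when that end falls inside the interval of
  -- a. At the second centre the upper end takes this role.
  first-centre-agrees : ∀ {c a} → inK c ≡ true → inK a ≡ false → lo a + y a ≡ m → hi a ≡ m + x a →
                      Agrees G word c a
  first-centre-agrees {c} {a} c∈K a∉K lo≡ hi≡ with cliquePlace c∈K
  ... | left p lo≡c hi≡c with ℕ.<-≤-connex (pos c) (x a)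
  ...   | inj₁ q = inj₁ (edge⇐ c∈K a∉K (inj₁ q) , acac c∈K a∉K
            (lo-≤ lo≡ lo≡c (ℕ.≤-trans (ℕ.m≤m+n m (pos c)) (ℕ.m≤m+n _ (y a))))
            (ends-< lo≡c hi≡ (ℕ.+-monoʳ-< m q))
            (ends-≤ hi≡ hi≡c (ℕ.≤-trans (ℕ.+-monoʳ-≤ m (x≤m a)) (ℕ.m≤m+n (m + m) (pos c)))))
  ...   | inj₂ q = inj₂ (low-nonneighbour c∈K a∉K p q , aacc c∈K a∉K
            (lo<hi a∉K) (ends-≤ hi≡ lo≡c (ℕ.+-monoʳ-≤ m q)) (lo<hi-clique c∈K))
  first-centre-agrees {c} {a} c∈K a∉K lo≡ hi≡ | right p lo≡c hi≡c with ℕ.<-≤-connex (pos c + y a) m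
  ...   | inj₁ q = inj₂ (high-nonneighbour c∈K a∉K p q , caac c∈K a∉K
            (<-lo lo≡ lo≡c q) (lo<hi a∉K) (ends-≤ hi≡ hi≡c (ℕ.+-monoʳ-≤ m (ℕ.≤-trans (x≤t a) p))))
  ...   | inj₂ q = inj₁ (edge⇐ c∈K a∉K (inj₂ q) , acac c∈K a∉K
            (lo-≤ lo≡ lo≡c q)
            (ends-< lo≡c hi≡ (ℕ.<-≤-trans (pos<m c∈K) (ℕ.m≤m+n m (x a))))
            (ends-≤ hi≡ hi≡c (ℕ.+-monoʳ-≤ m (ℕ.≤-trans (x≤t a) p))))

  second-centre-agrees : ∀ {c a} → inK c ≡ true → inK a ≡ false → lo a + y a ≡ m + m → hi a ≡ m + m + x a →
                       Agrees G word c a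
  second-centre-agrees {c} {a} c∈K a∉K lo≡ hi≡ with cliquePlace c∈K
  ... | left p lo≡c hi≡c with ℕ.<-≤-connex (pos c) (x a)
  ...   | inj₁ q = inj₁ (edge⇐ c∈K a∉K (inj₁ q) , caca c∈K a∉K
            (<-lo lo≡ lo≡c (m+-< (pos c) (y a) (pos+y<m a p)))
            (lo-≤ lo≡ hi≡c (ℕ.≤-trans (ℕ.m≤m+n (m + m) (pos c)) (ℕ.m≤m+n _ (y a))))
            (ends-< hi≡c hi≡ (ℕ.+-monoʳ-< (m + m) q)))
  ...   | inj₂ q = inj₂ (low-nonneighbour c∈K a∉K p q , caac c∈K a∉K
            (<-lo lo≡ lo≡c (m+-< (pos c) (y a) (pos+y<m a p)))
            (lo<hi a∉K) (ends-≤ hi≡ hi≡c (ℕ.+-monoʳ-≤ (m + m) q)))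
  second-centre-agrees {c} {a} c∈K a∉K lo≡ hi≡ | right p lo≡c hi≡c with ℕ.<-≤-connex (pos c + y a) m
  ...   | inj₁ q = inj₂ (high-nonneighbour c∈K a∉K p q , ccaa c∈K a∉K
            (lo<hi-clique c∈K) (<-lo lo≡ hi≡c (m+-< (pos c) (y a) q)) (lo<hi a∉K))
  ...   | inj₂ q = inj₁ (edge⇐ c∈K a∉K (inj₂ q) , caca c∈K a∉K
            (<-lo lo≡ lo≡c (ℕ.+-mono-<-≤ (pos<m c∈K) (y≤m a)))
            (lo-≤ lo≡ hi≡c (m+-≤ (pos c) (y a) q))
            (ends-< hi≡c hi≡ (ℕ.<-≤-trans (ℕ.+-monoʳ-< m (pos<m c∈K)) (ℕ.m≤m+n (m + m) (x a)))))

  mixed-agrees : ∀ {c a} → inK c ≡ true → inK a ≡ false → Agrees G word c a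
  mixed-agrees {c} {a} c∈K a∉K with place a∉K
  ... | isolated x≡0 y≡0 lo≡ hi≡ = inj₂
    ( (λ e → [ (λ p → ℕ.n≮0 (subst (pos c <_) x≡0 p))
             , (λ p → ℕ.<⇒≱ (pos<m c∈K) (subst (m ≤_) (≡.trans (cong (pos c +_) y≡0) (ℕ.+-identityʳ _)) p)) ]′
             (edge⇒ c∈K a∉K e))
    , ccaa c∈K a∉K (lo<hi-clique c∈K)
        (ends-< (hi-clique c∈K) (≡.trans lo≡ (ℕ.+-assoc m m m))
          (ℕ.+-monoʳ-< m (ℕ.<-≤-trans (lo<m+t c∈K) (ℕ.+-monoʳ-≤ m (t≤m c)))))
        (lo<hi a∉K))
  ... | coloured _ lo≡ hi≡ = [ (λ e → first-centre-agrees c∈K a∉K (≡.trans lo≡ e) (≡.trans hi≡ (cong (_+ x a) e)))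
                             , (λ e → second-centre-agrees c∈K a∉K (≡.trans lo≡ e) (≡.trans hi≡ (cong (_+ x a) e))) ]′
                             (centre-cases a)

  ¬alternate-sym : ∀ {a b} → ¬ Alternate word a b → ¬ Alternate word b a
  ¬alternate-sym {a} {b} ¬alt = ¬alt ∘ subst NoTwoConsecutiveEqual (restrict-comm word b a)

  same-centre : ∀ {a b} → a ≢ b → inK a ≡ false → inK b ≡ false → lo a + y a ≡ centre a → hi a ≡ centre a + x a →
                lo b + y b ≡ centre b → hi b ≡ centre b + x b → col a ≡ col b → x a ≤ x b → ¬ Alternate word a b
  same-centre {a} {b} a≢b a∉K b∉K lo≡a hi≡a lo≡b hi≡b col≡ xa≤xb = go (ℕ.≤-<-connex (y a) (y b))
    where
    centre≡ : centre a ≡ centre b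
    centre≡ = cong (λ z → if z then m else m + m) col≡
    lo-anti : ∀ {u v} → lo u + y u ≡ centre u → lo v + y v ≡ centre v → centre u ≡ centre v →
              y u ≤ y v → lo v ≤ lo u
    lo-anti {u} {v} lo≡u lo≡v eq yu≤yv = ℕ.+-cancelʳ-≤ (y v) (lo v) (lo u)
      (subst (_≤ lo u + y v) (≡.trans lo≡u (≡.trans eq (≡.sym lo≡v))) (ℕ.+-monoʳ-≤ (lo u) yu≤yv))
    hi-mono : hi a ≤ hi b
    hi-mono = ends-≤ (≡.trans hi≡a (cong (_+ x a) centre≡)) hi≡b (ℕ.+-monoʳ-≤ (centre b) xa≤xb)
    go : y a ≤ y b ⊎ y b < y a → ¬ Alternate word a b
    go (inj₁ ya≤yb) = inside a≢b a∉K b∉K (lo<hi a∉K) (lo-anti lo≡a lo≡b centre≡ ya≤yb) hi-mono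
    go (inj₂ yb<ya) with ℕ.m≤n⇒m<n∨m≡n xa≤xb
    ... | inj₂ xa≡xb = ¬alternate-sym {b} {a} (inside (a≢b ∘ ≡.sym) b∉K a∉K (lo<hi b∉K)
      (lo-anti lo≡b lo≡a (≡.sym centre≡) (ℕ.<⇒≤ yb<ya))
      (ℕ.≤-reflexive (≡.trans hi≡b (≡.trans (cong₂ _+_ (≡.sym centre≡) (≡.sym xa≡xb)) (≡.sym hi≡a)))))
    ... | inj₁ xa<xb with x a ℕ.≟ 0 | y b ℕ.≟ 0
    ...   | no xa≢0 | _ = contradiction col≡ (proj₂ colouring ((xa<xb , yb<ya) , inj₁ (ℕ.n≢0⇒n>0 xa≢0)))
    ...   | _ | no yb≢0 = contradiction col≡ (proj₂ colouring ((xa<xb , yb<ya) , inj₂ (ℕ.n≢0⇒n>0 yb≢0)))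
    -- The chord of a ends and that of b starts in the gap at the common centre; ends precede starts
    -- within a gap, so the chords are disjoint.
    ...   | yes xa≡0 | yes yb≡0 = apart a∉K b∉K (lo<hi a∉K) (lo<hi b∉K) (ℕ.≤-reflexive (begin
      hi a            ≡⟨ hi≡a ⟩
      centre a + x a  ≡⟨ cong (centre a +_) xa≡0 ⟩
      centre a + 0    ≡⟨ ℕ.+-identityʳ _ ⟩
      centre a        ≡⟨ centre≡ ⟩
      centre b        ≡⟨ lo≡b ⟨
      lo b + y b      ≡⟨ cong (lo b +_) yb≡0 ⟩
      lo b + 0        ≡⟨ ℕ.+-identityʳ _ ⟩
      lo b            ∎))
      where open ≡-Reasoning

  -- The two windows share only the gap m + t, where ends again precede starts.
  opposite-centres : ∀ {a b} → inK a ≡ false → inK b ≡ false → lo b + y b ≡ m + m → hi a ≡ m + x a →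
                     ¬ Alternate word a b
  opposite-centres {a} {b} a∉K b∉K lo≡ hi≡ = apart a∉K b∉K (lo<hi a∉K) (lo<hi b∉K)
    (ℕ.≤-trans (ends-≤ hi≡ refl (ℕ.+-monoʳ-≤ m (x≤t a)))
      (ℕ.+-cancelʳ-≤ (y b) (m + t) (lo b)
        (subst₂ _≤_ (≡.sym (ℕ.+-assoc m t (y b))) (≡.sym lo≡) (ℕ.+-monoʳ-≤ m (t+y≤m b)))))

  isolated-apart : ∀ {a b} → inK a ≡ false → inK b ≡ false → hi a ≡ centre a + x a → lo b ≡ m + m + m →
                   ¬ Alternate word a b
  isolated-apart {a} a∉K b∉K hi≡ lo≡ = apart a∉K b∉K (lo<hi a∉K) (lo<hi b∉K)
    (ends-≤ hi≡ lo≡ (ℕ.+-mono-≤ (centre≤ (col a)) (x≤m a)))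
    where
    centre≤ : ∀ z → (if z then m else m + m) ≤ m + m
    centre≤ true  = ℕ.m≤m+n m m
    centre≤ false = ℕ.≤-refl

  independent-¬alternate : ∀ {a b} → a ≢ b → inK a ≡ false → inK b ≡ false → ¬ Alternate word a b
  independent-¬alternate {a} {b} a≢b a∉K b∉K with place a∉K | place b∉K
  ... | isolated _ _ lo≡a hi≡a | isolated _ _ lo≡b hi≡b = inside a≢b a∉K b∉K (lo<hi a∉K)
    (ℕ.≤-reflexive (≡.trans lo≡b (≡.sym lo≡a))) (ℕ.≤-reflexive (≡.trans hi≡a (≡.sym hi≡b)))
  ... | isolated _ _ lo≡a _ | coloured _ _ hi≡b = ¬alternate-sym {b} {a} (isolated-apart b∉K a∉K hi≡b lo≡a)
  ... | coloured _ _ hi≡a | isolated _ _ lo≡b _ = isolated-apart a∉K b∉K hi≡a lo≡b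
  ... | coloured _ lo≡a hi≡a | coloured _ lo≡b hi≡b with col a Bool.≟ col b
  ...   | yes col≡ = [ same-centre a≢b a∉K b∉K lo≡a hi≡a lo≡b hi≡b col≡
                     , ¬alternate-sym {b} {a}
                       ∘ same-centre (a≢b ∘ ≡.sym) b∉K a∉K lo≡b hi≡b lo≡a hi≡a (≡.sym col≡) ]′
                     (ℕ.≤-total (x a) (x b))
  ...   | no col≢ = opposite (col a) (col b) refl refl
    where
    opposite : ∀ p q → col a ≡ p → col b ≡ q → ¬ Alternate word a b
    opposite true  true  ea eb = contradiction (≡.trans ea (≡.sym eb)) col≢
    opposite false false ea eb = contradiction (≡.trans ea (≡.sym eb)) col≢
    opposite true  false ea eb = opposite-centres a∉K b∉K
      (≡.trans lo≡b (centre-false {b} eb)) (≡.trans hi≡a (cong (_+ x a) (centre-true {a} ea)))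
    opposite false true  ea eb = ¬alternate-sym {b} {a} (opposite-centres b∉K a∉K
      (≡.trans lo≡a (centre-false {a} ea)) (≡.trans hi≡b (cong (_+ x b) (centre-true {b} eb))))

  agrees : ∀ {a b} → a ≢ b → Agrees G word a b
  agrees {a} {b} a≢b = go (inK a) (inK b) refl refl
    where
    go : ∀ p q → inK a ≡ p → inK b ≡ q → Agrees G word a b
    go true  true  a∈ b∈ = [ clique-agrees a∈ b∈ , Agrees-sym G word ∘ clique-agrees b∈ a∈ ]′ (lo≷ a≢b a∈ b∈)
    go true  false a∈ b∈ = mixed-agrees a∈ b∈
    go false true  a∈ b∈ = Agrees-sym G word (mixed-agrees b∈ a∈)
    go false false a∈ b∈ = inj₂ (independent a∈ b∈ , independent-¬alternate a≢b a∈ b∈)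

  representable : HasUniformRep G 2
  representable = word , count-word , agrees⇒represents G word agrees

-- Induced subgraphs inherit uniform words.

module Hereditary (G H : Graph) (contains : ContainsInduced G H) where

  private
    f : Fin (n H) → Fin (n G)
    f = proj₁ contains

    f-injective : Injective _≡_ _≡_ f
    f-injective = proj₁ (proj₂ contains)

    f-adj : ∀ i j → adj H i j ≡ adj G (f i) (f j)
    f-adj = proj₂ (proj₂ contains)

    preimage? : ∀ v → Dec (∃ λ i → f i ≡ v)
    preimage? v = Fin.any? λ i → f i ≟ v

  pull : List (Fin (n G)) → List (Fin (n H))
  pull [] = []
  pull (v ∷ w) with preimage? v
  ... | yes (i , _) = i ∷ pull w
  ... | no  _       = pull w

  filter-pull : {P : (Fin (n G)) → Set} {Q : (Fin (n H)) → Set} (P? : Decidable P) (Q? : Decidable Q) →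
                (∀ {i} → Q i → P (f i)) → (∀ {i} → P (f i) → Q i) → (∀ {v} → P v → ∃ λ i → f i ≡ v) →
                ∀ w → map f (filter Q? (pull w)) ≡ filter P? w
  filter-pull P? Q? Q⇒P P⇒Q image [] = refl
  filter-pull P? Q? Q⇒P P⇒Q image (v ∷ w) with preimage? v
  ... | no ¬i = ≡.trans (filter-pull P? Q? Q⇒P P⇒Q image w) (≡.sym (List.filter-reject P? (¬i ∘ image)))
  ... | yes (i , refl) with Q? i
  ...   | yes Qi = ≡.trans (cong (f i ∷_) (filter-pull P? Q? Q⇒P P⇒Q image w))
                          (≡.sym (List.filter-accept P? (Q⇒P Qi)))
  ...   | no ¬Qi = ≡.trans (filter-pull P? Q? Q⇒P P⇒Q image w) (≡.sym (List.filter-reject P? (¬Qi ∘ P⇒Q)))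

  restrict-pull : ∀ w a b → map f (restrict (pull w) a b) ≡ restrict w (f a) (f b)
  restrict-pull w a b = filter-pull _ _
    [ inj₁ ∘ cong f , inj₂ ∘ cong f ]′
    [ inj₁ ∘ f-injective , inj₂ ∘ f-injective ]′
    [ (λ v≡ → a , ≡.sym v≡) , (λ v≡ → b , ≡.sym v≡) ]′ w

  alternate-map⁺ : ∀ u → NoTwoConsecutiveEqual u → NoTwoConsecutiveEqual (map f u)
  alternate-map⁺ []          _       = tt
  alternate-map⁺ (_ ∷ [])    _       = tt
  alternate-map⁺ (_ ∷ y ∷ u) (x≢y , h) = x≢y ∘ f-injective , alternate-map⁺ (y ∷ u) h

  alternate-map⁻ : ∀ u → NoTwoConsecutiveEqual (map f u) → NoTwoConsecutiveEqual u
  alternate-map⁻ []          _       = tt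
  alternate-map⁻ (_ ∷ [])    _       = tt
  alternate-map⁻ (_ ∷ y ∷ u) (x≢y , h) = x≢y ∘ cong f , alternate-map⁻ (y ∷ u) h

  hereditary : HasUniformRep G k → HasUniformRep H k
  hereditary {k} (w , uniform , represents) = pull w , uniform′ , λ a b a≢b →
      (λ e → alternate-map⁻ (restrict (pull w) a b) (subst NoTwoConsecutiveEqual (≡.sym (restrict-pull w a b))
               (proj₁ (represents (f a) (f b) (a≢b ∘ f-injective)) (≡.trans (≡.sym (f-adj a b)) e))))
    , (λ alt → ≡.trans (f-adj a b) (proj₂ (represents (f a) (f b) (a≢b ∘ f-injective))
               (subst NoTwoConsecutiveEqual (restrict-pull w a b) (alternate-map⁺ (restrict (pull w) a b) alt))))
    where
    uniform′ : Uniform k (pull w)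
    uniform′ a = begin
      length (filter (_≟ a) (pull w))          ≡⟨ List.length-map f (filter (_≟ a) (pull w)) ⟨
      length (map f (filter (_≟ a) (pull w)))
        ≡⟨ cong length (filter-pull (_≟ f a) (_≟ a) (cong f) f-injective (λ v≡ → a , ≡.sym v≡) w) ⟩
      count (f a) w                            ≡⟨ uniform (f a) ⟩
      k                                        ∎
      where open ≡-Reasoning

-- Exhaustive search for a representing word.

insertions : ℕ → Fin h → List (Fin h) → List (List (Fin h))
insertions zero    v u       = [ u ]
insertions (suc k) v []      = map (v ∷_) (insertions k v [])
insertions (suc k) v (x ∷ u) = map (v ∷_) (insertions k v (x ∷ u)) ++ map (x ∷_) (insertions (suc k) v u)

without : Fin h → List (Fin h) → List (Fin h)
without v = filter (λ x → ¬? (x ≟ v))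

∈-insertions : ∀ (v : Fin h) w → count v w ≡ k → w ∈ insertions k v (without v w)
∈-insertions v [] refl = here refl
∈-insertions {k = k} v (x ∷ w) eq with x ≟ v
... | no x≢v = after k (without v w) (∈-insertions v w eq)
  where
  after : ∀ k u {w} → w ∈ insertions k v u → x ∷ w ∈ insertions k v (x ∷ u)
  after zero    u (here refl) = here refl
  after (suc k) u w∈ = ∈-++⁺ʳ _ (∈-map⁺ (x ∷_) w∈)
... | yes refl with suc k ← k = before (without v w) (∈-insertions v w (ℕ.suc-injective eq))
  where
  before : ∀ u {w} → w ∈ insertions k v u → v ∷ w ∈ insertions (suc k) v u
  before []      w∈ = ∈-map⁺ (v ∷_) w∈
  before (_ ∷ u) w∈ = ∈-++⁺ˡ (∈-map⁺ (v ∷_) w∈)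

noTwoConsecutiveEqual? : (u : List (Fin h)) → Dec (NoTwoConsecutiveEqual u)
noTwoConsecutiveEqual? []          = yes tt
noTwoConsecutiveEqual? (_ ∷ [])    = yes tt
noTwoConsecutiveEqual? (x ∷ y ∷ u) = ¬? (x ≟ y) ×-dec noTwoConsecutiveEqual? (y ∷ u)

filter-filter : ∀ {A : Set} {P Q R : A → Set} (P? : Decidable P) (Q? : Decidable Q) (R? : Decidable R) →
                (∀ {v} → P v → Q v → R v) → (∀ {v} → R v → P v × Q v) → ∀ w → filter P? (filter Q? w) ≡ filter R? w
filter-filter P? Q? R? to from [] = refl
filter-filter P? Q? R? to from (v ∷ w) with Q? v
... | no ¬Qv = ≡.trans (filter-filter P? Q? R? to from w) (≡.sym (List.filter-reject R? (¬Qv ∘ proj₂ ∘ from)))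
... | yes Qv with P? v
...   | yes Pv = ≡.trans (cong (v ∷_) (filter-filter P? Q? R? to from w)) (≡.sym (List.filter-accept R? (to Pv Qv)))
...   | no ¬Pv = ≡.trans (filter-filter P? Q? R? to from w) (≡.sym (List.filter-reject R? (¬Pv ∘ proj₁ ∘ from)))

-- Depth-first search through the k-uniform words over a growing set of letters that represent the
-- subgraph induced by these letters.
module Search (H : Graph) (k : ℕ) where

  V : Set
  V = Fin (n H)

  open import Data.List.Membership.DecPropositional (_≟_ {n H}) using (_∈?_)

  fits : V → List V → List V → Bool
  fits v u = all λ z → does (does (noTwoConsecutiveEqual? (restrict u v z)) Bool.≟ adj H v z)

  -- An exhausted order means that a word has survived, hence `false`. The membership test rejects
  -- an order that repeats a letter, where k further copies would break uniformity.
  refuted : List V → List V → List V → Bool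
  refuted placed []         u = false
  refuted placed (v ∷ rest) u = not (does (v ∈? placed)) ∧
    all (λ u′ → not (fits v u′ placed) ∨ refuted (v ∷ placed) rest u′) (insertions k v u)

  module _ (w : List V) (uniform : Uniform k w) (represents : Represents H w) where

    section : List V → List V
    section placed = filter (_∈? placed) w

    restrict-section : ∀ {v z placed} → v ∈ placed → z ∈ placed → restrict (section placed) v z ≡ restrict w v z
    restrict-section v∈ z∈ = filter-filter _ _ _ (λ r _ → r)
      (λ r → r , [ (λ { refl → v∈ }) , (λ { refl → z∈ }) ]′ r) w

    section-fits : ∀ v {placed} → v ∉ placed → T (fits v (section (v ∷ placed)) placed)
    section-fits v {placed} v∉ = All.all⁻ _ (All.tabulate fit)
      where
      fit : ∀ {z} → z ∈ placed →
            T (does (does (noTwoConsecutiveEqual? (restrict (section (v ∷ placed)) v z)) Bool.≟ adj H v z))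
      fit {z} z∈ = subst T (≡.sym (dec-true (_ Bool.≟ _) agree)) tt
        where
        v≢z : v ≢ z
        v≢z refl = v∉ z∈
        agree : does (noTwoConsecutiveEqual? (restrict (section (v ∷ placed)) v z)) ≡ adj H v z
        agree rewrite restrict-section {v} {z} {v ∷ placed} (here refl) (there z∈) with adj H v z in e
        ... | true  = dec-true (noTwoConsecutiveEqual? _) (proj₁ (represents v z v≢z) e)
        ... | false = dec-false (noTwoConsecutiveEqual? _) λ alt →
          contradiction (≡.trans (≡.sym (proj₂ (represents v z v≢z) alt)) e) λ ()

    count-section : ∀ v placed → count v (section (v ∷ placed)) ≡ k
    count-section v placed = ≡.trans
      (cong length (filter-filter _ _ _ (λ v≡ _ → v≡) (λ { refl → refl , here refl }) w)) (uniform v)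

    without-section : ∀ v placed → v ∉ placed → without v (section (v ∷ placed)) ≡ section placed
    without-section v placed v∉ = filter-filter _ _ _
      (λ x≢v → λ { (here x≡v) → contradiction x≡v x≢v ; (there x∈) → x∈ })
      (λ x∈ → (λ { refl → v∉ x∈ }) , there x∈) w

    -- The sections of a genuine representing word trace a branch that survives every test: each
    -- arises from the previous one by inserting the k copies of the new letter.
    refuted-sound : ∀ placed rest → ¬ T (refuted placed rest (section placed))
    refuted-sound placed (v ∷ rest) r with v ∈? placed
    ... | no v∉ = [ excluded , refuted-sound (v ∷ placed) rest ]′ (Equivalence.to Bool.T-∨ found)
      where
      found : T (not (fits v (section (v ∷ placed)) placed) ∨ refuted (v ∷ placed) rest (section (v ∷ placed)))
      found = All.lookup (All.all⁺ _ _ r)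
        (subst (λ u → section (v ∷ placed) ∈ insertions k v u) (without-section v placed v∉)
          (∈-insertions v (section (v ∷ placed)) (count-section v placed)))
      excluded : ¬ T (not (fits v (section (v ∷ placed)) placed))
      excluded t with fits v (section (v ∷ placed)) placed | section-fits v v∉
      ... | true | _ = t

  unrepresentable : ∀ order → refuted [] order [] ≡ true → ¬ HasUniformRep H k
  unrepresentable order r (w , uniform , represents) =
    refuted-sound w uniform represents [] order 
      (subst T (≡.sym (≡.trans (cong (refuted [] order) nothing) r)) tt)
    where
    nothing : section w uniform represents [] ≡ []
    nothing = List.filter-none (_∈? []) {w} (All.tabulate λ _ ())

-- The orders of insertion below keep the search trees small.
F₀-no1 : ¬ HasUniformRep F₀ 1
F₀-no1 = Search.unrepresentable F₀ 1 (# 3 ∷ # 7 ∷ # 6 ∷ []) refl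

-- In a 1-uniform word any two letters alternate, so a single non-adjacent pair suffices, here c₄
-- and b₁.
F₁₅-no1 : ¬ HasUniformRep F₁₅ 1
F₁₅-no1 = Search.unrepresentable F₁₅ 1 (# 3 ∷ # 4 ∷ []) refl

F₀-no2 : ¬ HasUniformRep F₀ 2
F₀-no2 = Search.unrepresentable F₀ 2 (# 3 ∷ # 7 ∷ # 6 ∷ # 1 ∷ # 4 ∷ # 2 ∷ # 5 ∷ # 0 ∷ []) refl

F₁₅-no2 : ¬ HasUniformRep F₁₅ 2
F₁₅-no2 = Search.unrepresentable F₁₅ 2 (# 3 ∷ # 1 ∷ # 8 ∷ # 2 ∷ # 4 ∷ # 5 ∷ # 0 ∷ # 7 ∷ # 6 ∷ []) refl

-- Finding `F₀` and `F₁₅` as induced subgraphs.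

-- The first p vertices form a clique, the last q an independent set, and the vertices on either side
-- are told apart by their neighbours on the other side.
module SplitPattern {p q : ℕ} (adjH : Fin (p + q) → Fin (p + q) → Bool) where

  mixed : Fin p → Fin q → Bool
  mixed i j = adjH (i ↑ˡ q) (p ↑ʳ j)

  IsSplitPattern : Set
  IsSplitPattern =
      (∀ i i′ → i ≡ i′ ⊎ adjH (i ↑ˡ q) (i′ ↑ˡ q) ≡ true × ∃ λ j → mixed i j ≢ mixed i′ j)
    × (∀ j j′ → adjH (p ↑ʳ j) (p ↑ʳ j′) ≡ false × (j ≡ j′ ⊎ ∃ λ i → mixed i j ≢ mixed i j′))

  isSplitPattern? : Dec IsSplitPattern
  isSplitPattern? =
    (Fin.all? λ i → Fin.all? λ i′ → (i ≟ i′) ⊎-dec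
      ((adjH (i ↑ˡ q) (i′ ↑ˡ q) Bool.≟ true) ×-dec Fin.any? λ j → ¬? (mixed i j Bool.≟ mixed i′ j)))
    ×-dec
    (Fin.all? λ j → Fin.all? λ j′ → (adjH (p ↑ʳ j) (p ↑ʳ j′) Bool.≟ false) ×-dec
      ((j ≟ j′) ⊎-dec Fin.any? λ i → ¬? (mixed i j Bool.≟ mixed i j′)))

  data Side : Fin (p + q) → Set where
    cliqueSide      : ∀ i → Side (i ↑ˡ q)
    independentSide : ∀ j → Side (p ↑ʳ j)

  side : ∀ k → Side k
  side k with splitAt p k in eq
  ... | inj₁ i = subst Side (Fin.splitAt⁻¹-↑ˡ eq) (cliqueSide i)
  ... | inj₂ j = subst Side (Fin.splitAt⁻¹-↑ʳ eq) (independentSide j)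

  module Embed {G : Graph} (C : Coordinates G) (isPattern : IsSplitPattern)
               (symH : ∀ k l → adjH k l ≡ adjH l k) (irreflH : ∀ k → adjH k k ≡ false)
               (cs : Fin p → Fin (n G)) (as : Fin q → Fin (n G)) where
    open Coordinates C

    f : Fin (p + q) → Fin (n G)
    f k = [ cs , as ]′ (splitAt p k)

    f-clique : ∀ i → f (i ↑ˡ q) ≡ cs i
    f-clique i = cong [ cs , as ]′ (Fin.splitAt-↑ˡ p i q)

    f-independent : ∀ j → f (p ↑ʳ j) ≡ as j
    f-independent j = cong [ cs , as ]′ (Fin.splitAt-↑ʳ p q j)

    -- Vertices with equal images would have equal mixed adjacencies, so the pattern forces
    -- injectivity; the clique and the independent set then settle all remaining adjacencies.
    embed : (∀ i → inK (cs i) ≡ true) → (∀ j → inK (as j) ≡ false) → (∀ i j → mixed i j ≡ adj G (cs i) (as j)) →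
            Σ (Fin (p + q) → Fin (n G)) λ f → Injective _≡_ _≡_ f × (∀ k l → adjH k l ≡ adj G (f k) (f l))
    embed cs∈K as∉K mixed≡ = f , (λ {k} {l} → injective (side k) (side l)) , λ k l → preserves (side k) (side l)
      where
      cs-injective : ∀ i i′ → cs i ≡ cs i′ → i ≡ i′
      cs-injective i i′ eq with proj₁ isPattern i i′
      ... | inj₁ i≡i′         = i≡i′
      ... | inj₂ (_ , j , ≢) = contradiction
        (≡.trans (mixed≡ i j) (≡.trans (cong (λ c → adj G c (as j)) eq) (≡.sym (mixed≡ i′ j)))) ≢

      as-injective : ∀ j j′ → as j ≡ as j′ → j ≡ j′
      as-injective j j′ eq with proj₂ (proj₂ isPattern j j′)
      ... | inj₁ j≡j′     = j≡j′
      ... | inj₂ (i , ≢) = contradiction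
        (≡.trans (mixed≡ i j) (≡.trans (cong (adj G (cs i)) eq) (≡.sym (mixed≡ i j′)))) ≢

      cs≢as : ∀ i j → cs i ≢ as j
      cs≢as i j eq = contradiction (≡.trans (≡.sym (cs∈K i)) (≡.trans (cong inK eq) (as∉K j))) λ ()

      injective : ∀ {k l} → Side k → Side l → f k ≡ f l → k ≡ l
      injective (cliqueSide i) (cliqueSide i′) eq =
        cong (_↑ˡ q) (cs-injective i i′ (≡.trans (≡.sym (f-clique i)) (≡.trans eq (f-clique i′))))
      injective (independentSide j) (independentSide j′) eq =
        cong (p ↑ʳ_) (as-injective j j′ (≡.trans (≡.sym (f-independent j)) (≡.trans eq (f-independent j′))))
      injective (cliqueSide i) (independentSide j) eq =
        contradiction (≡.trans (≡.sym (f-clique i)) (≡.trans eq (f-independent j))) (cs≢as i j)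
      injective (independentSide j) (cliqueSide i) eq =
        contradiction (≡.trans (≡.sym (f-clique i)) (≡.trans (≡.sym eq) (f-independent j))) (cs≢as i j)

      preserves : ∀ {k l} → Side k → Side l → adjH k l ≡ adj G (f k) (f l)
      preserves (cliqueSide i) (cliqueSide i′) rewrite f-clique i | f-clique i′ with i ≟ i′
      ... | yes refl = ≡.trans (irreflH _) (≡.sym (irrefl G (cs i)))
      ... | no i≢i′ with proj₁ isPattern i i′
      ...   | inj₁ i≡i′     = contradiction i≡i′ i≢i′
      ...   | inj₂ (e , _) = ≡.trans e (≡.sym (clique (i≢i′ ∘ cs-injective i i′) (cs∈K i) (cs∈K i′)))
      preserves (independentSide j) (independentSide j′) rewrite f-independent j | f-independent j′ =
        ≡.trans (proj₁ (proj₂ isPattern j j′)) (≡.sym (¬-not (independent (as∉K j) (as∉K j′))))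
      preserves (cliqueSide i) (independentSide j) rewrite f-clique i | f-independent j = mixed≡ i j
      preserves (independentSide j) (cliqueSide i) rewrite f-clique i | f-independent j =
        ≡.trans (symH _ _) (≡.trans (mixed≡ i j) (sym G _ _))

module Patterns {G : Graph} (C : Coordinates G) where
  open Coordinates C
  open Points x y using (_◁_)

  x-independent : ∀ {a} → 0 < x a → inK a ≡ false
  x-independent 0<x = ¬-not λ a∈K → ℕ.m<n⇒n≢0 0<x (x-clique a∈K)

  y-independent : ∀ {a} → 0 < y a → inK a ≡ false
  y-independent 0<y = ¬-not λ a∈K → ℕ.m<n⇒n≢0 0<y (y-clique a∈K)

  adjacent : ∀ {c a} → inK c ≡ true → inK a ≡ false → pos c < x a ⊎ m ≤ pos c + y a → true ≡ adj G c a
  adjacent c∈K a∉K h = ≡.sym (edge⇐ c∈K a∉K h)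

  -- The witness b gives pos c < x b ≤ t, whereas every final segment starts at t or later; hence
  -- only the initial segment of a could contain c.
  x-nonadjacent : ∀ {c a} b → inK c ≡ true → inK a ≡ false → pos c < x b → x a ≤ pos c → false ≡ adj G c a
  x-nonadjacent {c} {a} b c∈K a∉K c<b a≤c = ≡.sym (¬-not λ e →
    [ ℕ.≤⇒≯ a≤c , ℕ.<⇒≱ (ℕ.<-≤-trans (ℕ.+-monoˡ-< (y a) (ℕ.<-≤-trans c<b (x≤t b))) (t+y≤m a)) ]′ (edge⇒ c∈K a∉K e))

  y-nonadjacent : ∀ {c a} b → inK c ≡ true → inK a ≡ false → m ≤ pos c + y b → pos c + y a < m → false ≡ adj G c a
  y-nonadjacent {c} {a} b c∈K a∉K b≤c c<a = ≡.sym (¬-not λ e →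
    [ ℕ.≤⇒≯ (ℕ.≤-trans (x≤t a) (ℕ.+-cancelʳ-≤ (y b) t (pos c) (ℕ.≤-trans (t+y≤m b) b≤c)))
    , ℕ.<⇒≱ c<a ]′ (edge⇒ c∈K a∉K e))

  further : ∀ {c a b} → m ≤ pos c + y a → y a ≤ y b → m ≤ pos c + y b
  further {c} p q = ℕ.≤-trans p (ℕ.+-monoʳ-≤ (pos c) q)

  closer : ∀ {c a b} → pos c + y b < m → y a ≤ y b → pos c + y a < m
  closer {c} p q = ℕ.≤-<-trans (ℕ.+-monoʳ-≤ (pos c) q) p

  -- Along the chain the initial segments grow and the final ones shrink. The growth from a₁ to a₂
  -- to a₃ supplies c₄ and c₁, the shrinking supplies c₂ and c₃. The vertex 0 lies in all three
  -- initial segments or in all three final ones, as the last hypothesis permits.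
  contains-F₀ : ∀ {a₁ a₂ a₃} → a₁ ◁ a₂ → a₂ ◁ a₃ → 0 < x a₁ ⊎ 0 < y a₃ → ContainsInduced G F₀
  contains-F₀ {a₁} {a₂} {a₃} (x₁<x₂ , y₂<y₁) (x₂<x₃ , y₃<y₂) off
    with c₁ , ∈c₁ , x₂≤c₁ , c₁<x₃ ← x-separate x₂<x₃
    with c₂ , ∈c₂ , c₂<y₂ , y₁≤c₂ ← y-separate y₂<y₁
    with c₃ , ∈c₃ , c₃<y₃ , y₂≤c₃ ← y-separate y₃<y₂
    with c₄ , ∈c₄ , x₁≤c₄ , c₄<x₂ ← x-separate x₁<x₂
    = SplitPattern.Embed.embed {5} {3} (adj F₀) C
        (toWitness {a? = SplitPattern.isSplitPattern? {5} {3} (adj F₀)} _)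
        (sym F₀) (irrefl F₀) (lookup (proj₁ common ∷ c₁ ∷ c₂ ∷ c₃ ∷ c₄ ∷ [])) (lookup (a₁ ∷ a₂ ∷ a₃ ∷ []))
        (λ { 0F → proj₁ (proj₂ common) ; 1F → ∈c₁ ; 2F → ∈c₂ ; 3F → ∈c₃ ; 4F → ∈c₄ })
        (λ { 0F → ∉₁ ; 1F → ∉₂ ; 2F → ∉₃ })
        λ { 0F 0F → proj₁ (proj₂ (proj₂ common))
          ; 0F 1F → proj₁ (proj₂ (proj₂ (proj₂ common)))
          ; 0F 2F → proj₂ (proj₂ (proj₂ (proj₂ common)))
          ; 1F 0F → x-nonadjacent a₃ ∈c₁ ∉₁ c₁<x₃ (ℕ.≤-trans (ℕ.<⇒≤ x₁<x₂) x₂≤c₁)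
          ; 1F 1F → x-nonadjacent a₃ ∈c₁ ∉₂ c₁<x₃ x₂≤c₁
          ; 1F 2F → adjacent ∈c₁ ∉₃ (inj₁ c₁<x₃)
          ; 2F 0F → adjacent ∈c₂ ∉₁ (inj₂ y₁≤c₂)
          ; 2F 1F → y-nonadjacent a₁ ∈c₂ ∉₂ y₁≤c₂ c₂<y₂
          ; 2F 2F → y-nonadjacent a₁ ∈c₂ ∉₃ y₁≤c₂ (closer {c₂} {a₃} {a₂} c₂<y₂ (ℕ.<⇒≤ y₃<y₂))
          ; 3F 0F → adjacent ∈c₃ ∉₁ (inj₂ (further {c₃} {a₂} {a₁} y₂≤c₃ (ℕ.<⇒≤ y₂<y₁)))
          ; 3F 1F → adjacent ∈c₃ ∉₂ (inj₂ y₂≤c₃)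
          ; 3F 2F → y-nonadjacent a₂ ∈c₃ ∉₃ y₂≤c₃ c₃<y₃
          ; 4F 0F → x-nonadjacent a₂ ∈c₄ ∉₁ c₄<x₂ x₁≤c₄
          ; 4F 1F → adjacent ∈c₄ ∉₂ (inj₁ c₄<x₂)
          ; 4F 2F → adjacent ∈c₄ ∉₃ (inj₁ (ℕ.<-trans c₄<x₂ x₂<x₃))
          }
    where
    ∉₁ : inK a₁ ≡ false
    ∉₁ = y-independent (ℕ.≤-<-trans z≤n y₂<y₁)
    ∉₂ : inK a₂ ≡ false
    ∉₂ = x-independent (ℕ.≤-<-trans z≤n x₁<x₂)
    ∉₃ : inK a₃ ≡ false
    ∉₃ = x-independent (ℕ.≤-<-trans z≤n x₂<x₃)
    common : ∃ λ c → inK c ≡ true × true ≡ adj G c a₁ × true ≡ adj G c a₂ × true ≡ adj G c a₃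
    common = [ (λ 0<x₁ → let c , ∈c , c<x₁ = x-positive 0<x₁ in c , ∈c
                 , adjacent ∈c ∉₁ (inj₁ c<x₁)
                 , adjacent ∈c ∉₂ (inj₁ (ℕ.<-trans c<x₁ x₁<x₂))
                 , adjacent ∈c ∉₃ (inj₁ (ℕ.<-trans c<x₁ (ℕ.<-trans x₁<x₂ x₂<x₃))))
             , (λ 0<y₃ → let c , ∈c , y₃≤c = y-positive 0<y₃ in c , ∈c
                 , adjacent ∈c ∉₁ (inj₂ (further {c} {a₃} {a₁} y₃≤c (ℕ.<⇒≤ (ℕ.<-trans y₃<y₂ y₂<y₁))))
                 , adjacent ∈c ∉₂ (inj₂ (further {c} {a₃} {a₂} y₃≤c (ℕ.<⇒≤ y₃<y₂)))
                 , adjacent ∈c ∉₃ (inj₂ y₃≤c)) ]′ off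

  x-below-both : ∀ {u v} → 0 < x u → 0 < x v → ∃ λ c → inK c ≡ true × pos c < x u × pos c < x v
  x-below-both {u} {v} 0<u 0<v with ℕ.≤-total (x u) (x v)
  ... | inj₁ u≤v = let c , ∈c , c<u = x-positive 0<u in c , ∈c , c<u , ℕ.<-≤-trans c<u u≤v
  ... | inj₂ v≤u = let c , ∈c , c<v = x-positive 0<v in c , ∈c , ℕ.<-≤-trans c<v v≤u , c<v

  y-below-both : ∀ {u v} → 0 < y u → 0 < y v → ∃ λ c → inK c ≡ true × m ≤ pos c + y u × m ≤ pos c + y v
  y-below-both {u} {v} 0<u 0<v with ℕ.≤-total (y u) (y v)
  ... | inj₁ u≤v = let c , ∈c , u≤c = y-positive 0<u in c , ∈c , u≤c , further {c} {u} {v} u≤c u≤v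
  ... | inj₂ v≤u = let c , ∈c , v≤c = y-positive 0<v in c , ∈c , further {c} {v} {u} v≤c v≤u , v≤c

  x-between : ∀ {u v r s} → x u < x r → x u < x s → x v < x r → x v < x s →
              ∃ λ c → inK c ≡ true × (x u ≤ pos c × x v ≤ pos c) × (pos c < x r × pos c < x s)
  x-between {u} {v} {r} {s} u<r u<s v<r v<s with ℕ.≤-total (x u) (x v) | ℕ.≤-total (x r) (x s)
  ... | inj₁ u≤v | inj₁ r≤s = let c , ∈c , v≤c , c<r = x-separate v<r in
    c , ∈c , (ℕ.≤-trans u≤v v≤c , v≤c) , (c<r , ℕ.<-≤-trans c<r r≤s)
  ... | inj₁ u≤v | inj₂ s≤r = let c , ∈c , v≤c , c<s = x-separate v<s in
    c , ∈c , (ℕ.≤-trans u≤v v≤c , v≤c) , (ℕ.<-≤-trans c<s s≤r , c<s)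
  ... | inj₂ v≤u | inj₁ r≤s = let c , ∈c , u≤c , c<r = x-separate u<r in
    c , ∈c , (u≤c , ℕ.≤-trans v≤u u≤c) , (c<r , ℕ.<-≤-trans c<r r≤s)
  ... | inj₂ v≤u | inj₂ s≤r = let c , ∈c , u≤c , c<s = x-separate u<s in
    c , ∈c , (u≤c , ℕ.≤-trans v≤u u≤c) , (ℕ.<-≤-trans c<s s≤r , c<s)

  y-between : ∀ {u v r s} → y u < y r → y u < y s → y v < y r → y v < y s →
              ∃ λ c → inK c ≡ true × (pos c + y u < m × pos c + y v < m) × (m ≤ pos c + y r × m ≤ pos c + y s)
  y-between {u} {v} {r} {s} u<r u<s v<r v<s with ℕ.≤-total (y u) (y v) | ℕ.≤-total (y r) (y s)
  ... | inj₁ u≤v | inj₁ r≤s = let c , ∈c , v<c , c≤r = y-separate v<r in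
    c , ∈c , (closer {c} {u} {v} v<c u≤v , v<c) , (c≤r , further {c} {r} {s} c≤r r≤s)
  ... | inj₁ u≤v | inj₂ s≤r = let c , ∈c , v<c , c≤s = y-separate v<s in
    c , ∈c , (closer {c} {u} {v} v<c u≤v , v<c) , (further {c} {s} {r} c≤s s≤r , c≤s)
  ... | inj₂ v≤u | inj₁ r≤s = let c , ∈c , u<c , c≤r = y-separate u<r in
    c , ∈c , (u<c , closer {c} {v} {u} u<c v≤u) , (c≤r , further {c} {r} {s} c≤r r≤s)
  ... | inj₂ v≤u | inj₂ s≤r = let c , ∈c , u<c , c≤s = y-separate u<s in
    c , ∈c , (u<c , closer {c} {v} {u} u<c v≤u) , (further {c} {s} {r} c≤s s≤r , c≤s)

  -- The vertices c₁ and c₂ come from initial segments, c₃ and c₄ from final ones; c₂ and c₃ are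
  -- common to a₂ and both b's. The a's enter in reverse order, because the one adjacent to c₁ and
  -- c₂ is the one with y = 0.
  contains-F₁₅ : Obstruction {x = x} {y} → ContainsInduced G F₁₅
  contains-F₁₅ record { a₁ = a₁ ; a₂ = a₂ ; a₃ = a₃ ; b₁ = b₁ ; b₂ = b₂ ; x-a₁ = x₁≡0 ; y-a₃ = y₃≡0
                      ; a₁◁a₂ = x₁<x₂ , y₂<y₁ ; a₂◁a₃ = x₂<x₃ , y₃<y₂ ; b₂◁b₁ = xb₂<xb₁ , yb₁<yb₂
                      ; x-b₂ = 0<xb₂ ; y-b₁ = 0<yb₁ ; a₂<b₁ = x₂<xb₁
                      ; b₂<a₃ = xb₂<x₃ ; a₂<b₂ = y₂<yb₂ ; b₁<a₁ = yb₁<y₁ }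
    with c₁ , ∈c₁ , (x₂≤c₁ , xb₂≤c₁) , (c₁<x₃ , c₁<xb₁) ← x-between {a₂} {b₂} {a₃} {b₁} x₂<x₃ x₂<xb₁ xb₂<x₃ xb₂<xb₁
    with c₂ , ∈c₂ , c₂<x₂ , c₂<xb₂ ← x-below-both {a₂} {b₂} (ℕ.≤-<-trans z≤n x₁<x₂) 0<xb₂
    with c₃ , ∈c₃ , y₂≤c₃ , yb₁≤c₃ ← y-below-both {a₂} {b₁} (ℕ.≤-<-trans z≤n y₃<y₂) 0<yb₁
    with c₄ , ∈c₄ , (c₄<y₂ , c₄<yb₁) , (y₁≤c₄ , yb₂≤c₄) ← y-between {a₂} {b₁} {a₁} {b₂} y₂<y₁ y₂<yb₂ yb₁<y₁ yb₁<yb₂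
    = SplitPattern.Embed.embed {4} {5} (adj F₁₅) C
        (toWitness {a? = SplitPattern.isSplitPattern? {4} {5} (adj F₁₅)} _)
        (sym F₁₅) (irrefl F₁₅) (lookup (c₁ ∷ c₂ ∷ c₃ ∷ c₄ ∷ [])) (lookup (b₁ ∷ b₂ ∷ a₃ ∷ a₂ ∷ a₁ ∷ []))
        (λ { 0F → ∈c₁ ; 1F → ∈c₂ ; 2F → ∈c₃ ; 3F → ∈c₄ })
        (λ { 0F → ∉b₁ ; 1F → ∉b₂ ; 2F → ∉₃ ; 3F → ∉₂ ; 4F → ∉₁ })
        λ { 0F 0F → adjacent ∈c₁ ∉b₁ (inj₁ c₁<xb₁)
          ; 0F 1F → x-nonadjacent a₃ ∈c₁ ∉b₂ c₁<x₃ xb₂≤c₁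
          ; 0F 2F → adjacent ∈c₁ ∉₃ (inj₁ c₁<x₃)
          ; 0F 3F → x-nonadjacent a₃ ∈c₁ ∉₂ c₁<x₃ x₂≤c₁
          ; 0F 4F → x-nonadjacent a₃ ∈c₁ ∉₁ c₁<x₃ (subst (_≤ pos c₁) (≡.sym x₁≡0) z≤n)
          ; 1F 0F → adjacent ∈c₂ ∉b₁ (inj₁ (ℕ.<-trans c₂<xb₂ xb₂<xb₁))
          ; 1F 1F → adjacent ∈c₂ ∉b₂ (inj₁ c₂<xb₂)
          ; 1F 2F → adjacent ∈c₂ ∉₃ (inj₁ (ℕ.<-trans c₂<x₂ x₂<x₃))
          ; 1F 3F → adjacent ∈c₂ ∉₂ (inj₁ c₂<x₂)
          ; 1F 4F → x-nonadjacent a₂ ∈c₂ ∉₁ c₂<x₂ (subst (_≤ pos c₂) (≡.sym x₁≡0) z≤n)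
          ; 2F 0F → adjacent ∈c₃ ∉b₁ (inj₂ yb₁≤c₃)
          ; 2F 1F → adjacent ∈c₃ ∉b₂ (inj₂ (further {c₃} {b₁} {b₂} yb₁≤c₃ (ℕ.<⇒≤ yb₁<yb₂)))
          ; 2F 2F → y-nonadjacent a₂ ∈c₃ ∉₃ y₂≤c₃ (beyond-a₃ ∈c₃)
          ; 2F 3F → adjacent ∈c₃ ∉₂ (inj₂ y₂≤c₃)
          ; 2F 4F → adjacent ∈c₃ ∉₁ (inj₂ (further {c₃} {a₂} {a₁} y₂≤c₃ (ℕ.<⇒≤ y₂<y₁)))
          ; 3F 0F → y-nonadjacent a₁ ∈c₄ ∉b₁ y₁≤c₄ c₄<yb₁
          ; 3F 1F → adjacent ∈c₄ ∉b₂ (inj₂ yb₂≤c₄)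
          ; 3F 2F → y-nonadjacent a₁ ∈c₄ ∉₃ y₁≤c₄ (beyond-a₃ ∈c₄)
          ; 3F 3F → y-nonadjacent a₁ ∈c₄ ∉₂ y₁≤c₄ c₄<y₂
          ; 3F 4F → adjacent ∈c₄ ∉₁ (inj₂ y₁≤c₄)
          }
    where
    ∉₁ : inK a₁ ≡ false
    ∉₁ = y-independent (ℕ.≤-<-trans z≤n y₂<y₁)
    ∉₂ : inK a₂ ≡ false
    ∉₂ = x-independent (ℕ.≤-<-trans z≤n x₁<x₂)
    ∉₃ : inK a₃ ≡ false
    ∉₃ = x-independent (ℕ.≤-<-trans z≤n x₂<x₃)
    ∉b₁ : inK b₁ ≡ false
    ∉b₁ = y-independent 0<yb₁
    ∉b₂ : inK b₂ ≡ false
    ∉b₂ = x-independent 0<xb₂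
    beyond-a₃ : ∀ {c} → inK c ≡ true → pos c + y a₃ < m
    beyond-a₃ {c} ∈c = subst (_< m) (≡.sym (≡.trans (cong (pos c +_) y₃≡0) (ℕ.+-identityʳ (pos c)))) (pos<m ∈c)

  pattern⊎colouring : (ContainsInduced G F₀ ⊎ ContainsInduced G F₁₅) ⊎ Points.ProperColouring x y
  pattern⊎colouring with Fin.any? (λ a → Fin.any? (λ b → Fin.any? (λ c →
                           (a ◁? b) ×-dec (b ◁? c) ×-dec ((0 ℕ.<? x a) ⊎-dec (0 ℕ.<? y c)))))
    where open Points x y using (_◁?_)
  ... | yes (_ , _ , _ , a◁b , b◁c , off) = inj₁ (inj₁ (contains-F₀ a◁b b◁c off))
  ... | no ¬chain = [ inj₁ ∘ inj₂ ∘ contains-F₁₅ , inj₂ ]′ (Colourable⊎Obstructed λ {a} {b} {c} a◁b b◁c →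
      ℕ.n≤0⇒n≡0 (ℕ.≮⇒≥ λ 0<xa → ¬chain (a , b , c , a◁b , b◁c , inj₁ 0<xa))
    , ℕ.n≤0⇒n≡0 (ℕ.≮⇒≥ λ 0<yc → ¬chain (a , b , c , a◁b , b◁c , inj₂ 0<yc)))

theorem8 : (G : Graph) → IsSplit G → IsComparability G →
    (RepNumberIs G 3 → ContainsInduced G F₀ ⊎ ContainsInduced G F₁₅)
    × (ContainsInduced G F₀ ⊎ ContainsInduced G F₁₅ → RepNumberIs G 3)
theorem8 G split comparability = forward , backward
  where
  C : Coordinates G
  C = FromOrientation.coordinates G split comparability

  forward : RepNumberIs G 3 → ContainsInduced G F₀ ⊎ ContainsInduced G F₁₅
  forward (_ , minimal) = [ id
    , (λ colouring → contradiction (TwoUniform.representable C colouring) (minimal 2 (s≤s z≤n) ℕ.≤-refl)) ]′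
    (Patterns.pattern⊎colouring C)

  backward : ContainsInduced G F₀ ⊎ ContainsInduced G F₁₅ → RepNumberIs G 3
  backward contains = ThreeUniform.representable C , minimal contains
    where
    minimal : ContainsInduced G F₀ ⊎ ContainsInduced G F₁₅ → ∀ j → 1 ≤ j → j < 3 → ¬ HasUniformRep G j
    minimal (inj₁ F₀⊆G)  1 _ _ = F₀-no1  ∘ Hereditary.hereditary G F₀ F₀⊆G
    minimal (inj₁ F₀⊆G)  2 _ _ = F₀-no2  ∘ Hereditary.hereditary G F₀ F₀⊆G
    minimal (inj₂ F₁₅⊆G) 1 _ _ = F₁₅-no1 ∘ Hereditary.hereditary G F₁₅ F₁₅⊆G
    minimal (inj₂ F₁₅⊆G) 2 _ _ = F₁₅-no2 ∘ Hereditary.hereditary G F₁₅ F₁₅⊆G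
    minimal _ (suc (suc (suc _))) _ (s≤s (s≤s (s≤s ())))
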